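{- For an arbitrary snark $G$, the following statements are equivalent: (i) $G$ is bicritical; (ii) $G$ is $4$-vertex-critical; (iii) $G$ is $7$-irreducible; (iv) $G$ is irreducible.
   Context: Graphs may have parallel edges and loops. A snark is a connected cubic graph that admits no proper edge-colouring with three colours (equivalently, no nowhere-zero $4$-flow). For distinct vertices $u,v$ of $G$, $G-\{u,v\}$ denotes the graph obtained by removing $u$ and $v$ but retaining the edges formerly incident with them as dangling edges, and $G/\{u,v\}$ denotes the graph obtained by identifying $u$ and $v$. A snark $G$ is bicritical if $G-\{u,v\}$ is $3$-edge-colourable for every pair of distinct vertices $u,v$. A snark $G$ is $4$-vertex-critical if $G/\{u,v\}$ admits a nowhere-zero $4$-flow for every pair of distinct vertices $u,v$. For an integer $k\ge1$, a snark $G$ is $k$-irreducible if removing fewer than $k$ edges from $G$ never produces a component of chromatic index $4$ that can be completed (by adding vertices and edges) to a cubic graph $H$ with fewer vertices than $G$; $G$ is irreducible if it is $k$-irreducible for every $k\ge1$. -}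

module Defs where

open import Data.Nat using (ℕ; zero; suc; _+_; _<_; _≤_)
open import Data.Fin using (Fin; zero; suc; punchOut)
open import Data.Fin.Properties using () renaming (_≟_ to _≟ᶠ_)
open import Data.Maybe using (Maybe; just; nothing; map)
open import Data.Maybe.Properties using (≡-dec)
open import Data.Bool using (Bool; true; false; if_then_else_)
open import Data.Integer as ℤ using (ℤ; ∣_∣)
open import Data.Product using (Σ; Σ-syntax; _×_; _,_)
open import Data.Sum using (_⊎_)
open import Relation.Nullary using (¬_; Dec; yes; no)
open import Relation.Nullary.Decidable using (⌊_⌋)
open import Relation.Binary.PropositionalEquality using (_≡_; _≢_; sym)
open import Relation.Binary.Construct.Closure.ReflexiveTransitive using (Star)

-- Graphs with parallel edges, loops and dangling edges (multipoles).
-- Vertices are Fin nV, edges are Fin nE; every edge has two ends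
-- (Fin 2), each end is either attached to a vertex (just v) or free
-- (nothing).  A loop has both ends at the same vertex; a dangling
-- edge has one free end; an isolated edge has two free ends.
-- A "graph" in the ordinary sense is one with no free ends (IsGraph).

record Graph : Set where
  constructor mkGraph
  field
    nV  : ℕ
    nE  : ℕ
    end : Fin nE → Fin 2 → Maybe (Fin nV)
open Graph public

sumℕ : ∀ {m} → (Fin m → ℕ) → ℕ
sumℕ {zero}  f = 0
sumℕ {suc m} f = f zero + sumℕ (λ i → f (suc i))

sumℤ : ∀ {m} → (Fin m → ℤ) → ℤ
sumℤ {zero}  f = ℤ.0ℤ
sumℤ {suc m} f = f zero ℤ.+ sumℤ (λ i → f (suc i))

_≟ᵐ_ : ∀ {n} (x y : Maybe (Fin n)) → Dec (x ≡ y)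
_≟ᵐ_ = ≡-dec _≟ᶠ_

swap2 : Fin 2 → Fin 2
swap2 zero = suc zero
swap2 (suc _) = zero

IsGraph : Graph → Set
IsGraph G = ∀ e i → Σ[ v ∈ Fin (nV G) ] end G e i ≡ just v

-- degree: number of edge-ends at v (a loop counts twice)
deg : (G : Graph) → Fin (nV G) → ℕ
deg G v = sumℕ λ e → sumℕ λ i → if ⌊ end G e i ≟ᵐ just v ⌋ then 1 else 0

Cubic : Graph → Set
Cubic G = IsGraph G × (∀ v → deg G v ≡ 3)

Adj : (G : Graph) → Fin (nV G) → Fin (nV G) → Set
Adj G u v = Σ[ e ∈ Fin (nE G) ]
  ((end G e zero ≡ just u × end G e (suc zero) ≡ just v)
   ⊎ (end G e zero ≡ just v × end G e (suc zero) ≡ just u))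

Connected : Graph → Set
Connected G = ∀ u v → Star (Adj G) u v

-- proper 3-edge-colouring: distinct edge-ends meeting at a vertex get
-- distinct colours (so a loop prevents colourability); free ends impose
-- no constraint.
Colourable : Graph → Set
Colourable G = Σ[ c ∈ (Fin (nE G) → Fin 3) ]
  (∀ v e i e′ i′ → (e , i) ≢ (e′ , i′) →
     end G e i ≡ just v → end G e′ i′ ≡ just v → c e ≢ c e′)

Snark : Graph → Set
Snark G = Cubic G × Connected G × ¬ Colourable G

-- G - {u,v}: delete the vertices, keep incident edges as dangling edges.

delEnd : ∀ {k} → Fin (suc k) → Maybe (Fin (suc k)) → Maybe (Fin k)
delEnd u nothing = nothing
delEnd u (just w) with w ≟ᶠ u
... | yes _ = nothing
... | no w≢u = just (punchOut {i = u} {j = w} (λ eq → w≢u (sym eq)))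

delete1 : (G : Graph) → Fin (nV G) → Graph
delete1 (mkGraph zero m end) ()
delete1 (mkGraph (suc k) m end) u = mkGraph k m (λ e i → delEnd u (end e i))

remove2 : (G : Graph) (u v : Fin (nV G)) → u ≢ v → Graph
remove2 (mkGraph zero m end) () v ne
remove2 (mkGraph (suc k) m end) u v ne =
  delete1 (mkGraph k m (λ e i → delEnd u (end e i))) (punchOut {i = u} {j = v} ne)

mergeV : ∀ {k} (u v : Fin (suc k)) → u ≢ v → Fin (suc k) → Fin k
mergeV u v ne w with w ≟ᶠ v
... | yes _   = punchOut {i = v} {j = u} (λ eq → ne (sym eq))
... | no w≢v = punchOut {i = v} {j = w} (λ eq → w≢v (sym eq))

identify : (G : Graph) (u v : Fin (nV G)) → u ≢ v → Graph
identify (mkGraph zero m end) () v ne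
identify (mkGraph (suc k) m end) u v ne =
  mkGraph k m (λ e i → map (mergeV u v ne) (end e i))

-- Nowhere-zero 4-flow: an orientation o (o e = true reverses the
-- edge) and integer values with 1 ≤ |f e| ≤ 3, with Kirchhoff's law at
-- every vertex (inflow = outflow).

headE : (G : Graph) → (Fin (nE G) → Bool) → Fin (nE G) → Maybe (Fin (nV G))
headE G o e = if o e then end G e zero else end G e (suc zero)

tailE : (G : Graph) → (Fin (nE G) → Bool) → Fin (nE G) → Maybe (Fin (nV G))
tailE G o e = if o e then end G e (suc zero) else end G e zero

HasNZ4Flow : Graph → Set
HasNZ4Flow G = Σ[ o ∈ (Fin (nE G) → Bool) ] Σ[ f ∈ (Fin (nE G) → ℤ) ]
  ((∀ e → 1 ≤ ∣ f e ∣ × ∣ f e ∣ ≤ 3) ×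
   (∀ v → sumℤ (λ e → (if ⌊ headE G o e ≟ᵐ just v ⌋ then f e else ℤ.0ℤ)
                   ℤ.- (if ⌊ tailE G o e ≟ᵐ just v ⌋ then f e else ℤ.0ℤ))
          ≡ ℤ.0ℤ))

Bicritical : Graph → Set
Bicritical G = ∀ u v → (ne : u ≢ v) → Colourable (remove2 G u v ne)

FourVertexCritical : Graph → Set
FourVertexCritical G = ∀ u v → (ne : u ≢ v) → HasNZ4Flow (identify G u v ne)

-- Irreducibility.  F ⊆ E(G) is the set of removed edges; each removed
-- edge is split into two dangling edges, one at each former end.  A
-- component of the result is given by its vertex set S ⊆ V(G).

count : ∀ {m} → (Fin m → Bool) → ℕ
count F = sumℕ (λ e → if F e then 1 else 0)

module _ (G : Graph) (F : Fin (nE G) → Bool) (S : Fin (nV G) → Bool) where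

  AdjOff : Fin (nV G) → Fin (nV G) → Set
  AdjOff u v = Σ[ e ∈ Fin (nE G) ] F e ≡ false ×
    ((end G e zero ≡ just u × end G e (suc zero) ≡ just v)
     ⊎ (end G e zero ≡ just v × end G e (suc zero) ≡ just u))

  Component : Set
  Component =
    (Σ[ v ∈ Fin (nV G) ] S v ≡ true) ×
    (∀ e u v → F e ≡ false → end G e zero ≡ just u →
       end G e (suc zero) ≡ just v → S u ≡ S v) ×
    (∀ u v → S u ≡ true → S v ≡ true → Star AdjOff u v)

  -- the component (with the dangling halves of removed edges) is
  -- 3-edge-colourable: colours are given per edge-end; the two ends of
  -- a non-removed edge carry the same colour, the two halves of a
  -- removed edge are independent; properness at vertices of S.
  ComponentColourable : Set
  ComponentColourable = Σ[ c ∈ (Fin (nE G) → Fin 2 → Fin 3) ]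
    ((∀ e → F e ≡ false → c e zero ≡ c e (suc zero)) ×
     (∀ v → S v ≡ true → ∀ e i e′ i′ → (e , i) ≢ (e′ , i′) →
        end G e i ≡ just v → end G e′ i′ ≡ just v → c e i ≢ c e′ i′))

  Internal : Fin (nE G) → Set
  Internal e = F e ≡ false ×
    (∀ i → Σ[ v ∈ Fin (nV G) ] end G e i ≡ just v × S v ≡ true)

  -- the component can be completed, by adding vertices and edges, to a
  -- cubic graph H with fewer vertices than G: its vertices and internal
  -- edges embed injectively into H preserving incidences (the dangling
  -- edges are then completed by the remaining edge-ends of H).
  CompletableToSmaller : Set
  CompletableToSmaller = Σ[ H ∈ Graph ] Cubic H × nV H < nV G ×
    Σ[ φ ∈ (Fin (nV G) → Fin (nV H)) ] Σ[ ψ ∈ (Fin (nE G) → Fin (nE H)) ]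
      ((∀ u v → S u ≡ true → S v ≡ true → φ u ≡ φ v → u ≡ v) ×
       (∀ e e′ → Internal e → Internal e′ → ψ e ≡ ψ e′ → e ≡ e′) ×
       (∀ e → Internal e →
          (∀ i → end H (ψ e) i ≡ map φ (end G e i))
          ⊎ (∀ i → end H (ψ e) i ≡ map φ (end G e (swap2 i)))))

KIrreducible : ℕ → Graph → Set
KIrreducible k G = ∀ (F : Fin (nE G) → Bool) → count F < k →
  ∀ (S : Fin (nV G) → Bool) → Component G F S →
  ¬ ComponentColourable G F S → ¬ CompletableToSmaller G F S

Irreducible : Graph → Set
Irreducible G = ∀ k → 1 ≤ k → KIrreducible k G

{-# OPTIONS --safe #-}

-- A nowhere-zero 4-flow is the same as a nowhere-zero ℤ₂ × ℤ₂-flow: an even subgraph carries an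
-- integer flow with values ±1, so two even subgraphs a, b covering all edges give a + 2b, and
-- conversely f and (f + y) / 2 do, where y is the ±1-flow on the odd part of f.  The three nonzero
-- elements of ℤ₂ × ℤ₂ are the colours, and at a vertex of degree 3 Kirchhoff's law says that the
-- colours are distinct.  Hence a colouring of G − {u, v} is a flow on G / {u, v}; the law at the
-- merged vertex follows from the others.
--
-- If a component S embeds into a smaller cubic graph, then by parity at least two vertices lie
-- outside S, and a colouring of G without these two restricts to S.  Conversely, if G − {u, v}
-- is uncolourable, then so is one of its components; it is cut off by the at most six edges at u
-- and v, and joining the dangling edges of G − {u, v} in pairs embeds it into a cubic graph with
-- two vertices fewer than G.

module Submission where

open import Defs
open import Data.Bool using (Bool; true; false; if_then_else_)
open import Data.Bool.Properties using () renaming (_≟_ to _≟ᵇ_)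
open import Data.Fin using (Fin; zero; suc; punchIn; punchOut)
open import Data.Fin.Properties
  using (any?; all?; ¬∀⟶∃¬; injective⇒≤; punchIn-injective; punchInᵢ≢i;
    punchIn-punchOut; punchOut-injective; punchOut-punchIn; punchOut-cong)
  renaming (_≟_ to _≟ᶠ_)
open import Data.Integer using (ℤ; ∣_∣; 0ℤ; 1ℤ; -1ℤ; -[1+_]; _⊖_)
  renaming (+_ to nonneg; _+_ to _+ᶻ_; _*_ to _*ᶻ_; _-_ to _-ᶻ_; -_ to -ᶻ_)
import Data.Integer.Properties as ℤₚ
open import Data.Integer.Tactic.RingSolver using (solve-∀)
import Data.Nat.Tactic.RingSolver as ℕ-Solver
open import Data.Maybe using (Maybe; just; nothing; map; fromMaybe)
open import Data.Maybe.Properties using (just-injective)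
open import Data.Nat as ℕ using (ℕ; zero; suc; parity; _≤_; _<_; z≤n; s≤s; _+_)
import Data.Nat.Properties as ℕₚ
open import Algebra.Properties.CommutativeSemigroup ℕₚ.+-commutativeSemigroup using (interchange)
open import Data.Parity using (Parity; 0ℙ; 1ℙ)
  renaming (_+_ to _+ᵖ_; _*_ to _*ᵖ_)
import Data.Parity.Properties as ℙₚ
open import Data.Product using (Σ-syntax; ∃; _×_; _,_; proj₁; proj₂)
open import Data.Product.Properties using () renaming (≡-dec to ×-≡-dec)
open import Data.Sum using (_⊎_; inj₁; inj₂)
open import Data.Vec.Functional using (updateAt; _∷_)
open import Data.Vec.Functional.Properties using (updateAt-updates; updateAt-minimal)
open import Function using (_∘_; const)
open import Function.Bundles using (_⇔_; mk⇔)
open import Relation.Nullary using (¬_; Dec; yes; no; contradiction; _×-dec_; _⊎-dec_; _→-dec_; ¬?)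
open import Relation.Nullary.Decidable using (⌊_⌋; decidable-stable)
open import Relation.Binary.Construct.Closure.ReflexiveTransitive using (Star; _◅_; _◅◅_; gmap)
  renaming (ε to stay)
open import Relation.Binary.PropositionalEquality

private variable
  m n : ℕ

-- Integer sums

sumℤ-cong : {f g : Fin m → ℤ} → (∀ i → f i ≡ g i) → sumℤ f ≡ sumℤ g
sumℤ-cong {zero}  eq = refl
sumℤ-cong {suc m} eq = cong₂ _+ᶻ_ (eq zero) (sumℤ-cong (eq ∘ suc))

sumℤ-zero : {f : Fin m → ℤ} → (∀ i → f i ≡ 0ℤ) → sumℤ f ≡ 0ℤ
sumℤ-zero {zero}  eq = refl
sumℤ-zero {suc m} eq = cong₂ _+ᶻ_ (eq zero) (sumℤ-zero (eq ∘ suc))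

+-interchange : ∀ a b c d → (a +ᶻ b) +ᶻ (c +ᶻ d) ≡ (a +ᶻ c) +ᶻ (b +ᶻ d)
+-interchange = solve-∀

sumℤ-+ : (f g : Fin m → ℤ) → sumℤ (λ i → f i +ᶻ g i) ≡ sumℤ f +ᶻ sumℤ g
sumℤ-+ {zero}  f g = refl
sumℤ-+ {suc m} f g = trans (cong ((f zero +ᶻ g zero) +ᶻ_) (sumℤ-+ (f ∘ suc) (g ∘ suc)))
  (+-interchange (f zero) (g zero) (sumℤ (f ∘ suc)) (sumℤ (g ∘ suc)))

sumℤ-* : (k : ℤ) (f : Fin m → ℤ) → sumℤ (λ i → k *ᶻ f i) ≡ k *ᶻ sumℤ f
sumℤ-* {zero}  k f = sym (ℤₚ.*-zeroʳ k)
sumℤ-* {suc m} k f = trans (cong (k *ᶻ f zero +ᶻ_) (sumℤ-* k (f ∘ suc)))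
  (sym (ℤₚ.*-distribˡ-+ k (f zero) (sumℤ (f ∘ suc))))

sumℤ-swap : (f : Fin m → Fin n → ℤ) →
  sumℤ (λ i → sumℤ (λ j → f i j)) ≡ sumℤ (λ j → sumℤ (λ i → f i j))
sumℤ-swap {zero} {n} f = sym (sumℤ-zero {n} {λ _ → 0ℤ} λ _ → refl)
sumℤ-swap {suc m} f = trans (cong (sumℤ (f zero) +ᶻ_) (sumℤ-swap (f ∘ suc)))
  (sym (sumℤ-+ (f zero) (λ j → sumℤ (λ i → f (suc i) j))))

-- Two sums that agree off `j` differ by the values at `j`. The form without subtraction passes
-- directly through `parityℤ-+`.
sumℤ-update : (f g : Fin m → ℤ) (j : Fin m) → (∀ i → i ≢ j → f i ≡ g i) →
  sumℤ f +ᶻ g j ≡ sumℤ g +ᶻ f j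
sumℤ-update f g zero eq =
  trans (cong (λ s → (f zero +ᶻ s) +ᶻ g zero) (sumℤ-cong λ i → eq (suc i) λ ()))
        (rearrange (f zero) (sumℤ (g ∘ suc)) (g zero))
  where
  rearrange : ∀ a s b → (a +ᶻ s) +ᶻ b ≡ (b +ᶻ s) +ᶻ a
  rearrange = solve-∀
sumℤ-update f g (suc j) eq =
  trans (ℤₚ.+-assoc (f zero) (sumℤ (f ∘ suc)) (g (suc j)))
  (trans (cong₂ _+ᶻ_ (eq zero λ ())
     (sumℤ-update (f ∘ suc) (g ∘ suc) j λ i i≢j → eq (suc i) λ { refl → i≢j refl }))
  (sym (ℤₚ.+-assoc (g zero) (sumℤ (g ∘ suc)) (f (suc j)))))

-- Parity of integers

parityℤ : ℤ → Parity
parityℤ z = parity ∣ z ∣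

-- Mod 2 a difference is a sum: lowering both arguments by one flips both parities.
parity-⊖ : ∀ a b → parityℤ (a ⊖ b) ≡ parity a +ᵖ parity b
parity-⊖ a zero = sym (ℙₚ.+-identityʳ (parity a))
parity-⊖ zero (suc b) = refl
parity-⊖ (suc a) (suc b) = begin
  parityℤ (suc a ⊖ suc b)            ≡⟨ cong parityℤ (ℤₚ.[1+m]⊖[1+n]≡m⊖n a b) ⟩
  parityℤ (a ⊖ b)                    ≡⟨ parity-⊖ a b ⟩
  parity a +ᵖ parity b                ≡⟨ shift (parity a) (parity b) ⟩
  (1ℙ +ᵖ parity a) +ᵖ (1ℙ +ᵖ parity b)
    ≡⟨ cong₂ _+ᵖ_ (ℙₚ.+-homo-+ 1 a) (ℙₚ.+-homo-+ 1 b) ⟨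
  parity (suc a) +ᵖ parity (suc b)    ∎
  where
  open ≡-Reasoning
  shift : ∀ p q → p +ᵖ q ≡ (1ℙ +ᵖ p) +ᵖ (1ℙ +ᵖ q)
  shift 0ℙ 0ℙ = refl
  shift 0ℙ 1ℙ = refl
  shift 1ℙ 0ℙ = refl
  shift 1ℙ 1ℙ = refl

parityℤ-+ : ∀ i j → parityℤ (i +ᶻ j) ≡ parityℤ i +ᵖ parityℤ j
parityℤ-+ (nonneg a)    (nonneg b)    = ℙₚ.+-homo-+ a b
parityℤ-+ (nonneg a)    -[1+ b ] = parity-⊖ a (suc b)
parityℤ-+ -[1+ a ] (nonneg b)    = trans (parity-⊖ b (suc a)) (ℙₚ.+-comm (parity b) (parity (suc a)))
parityℤ-+ -[1+ a ] -[1+ b ] = trans (cong (parity ∘ suc) (sym (ℕₚ.+-suc a b))) (ℙₚ.+-homo-+ (suc a) (suc b))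

parityℤ-* : ∀ i j → parityℤ (i *ᶻ j) ≡ parityℤ i *ᵖ parityℤ j
parityℤ-* i j = trans (cong parity (ℤₚ.abs-* i j)) (ℙₚ.*-homo-* ∣ i ∣ ∣ j ∣)

parityℤ-neg : ∀ i → parityℤ (-ᶻ i) ≡ parityℤ i
parityℤ-neg i = cong parity (ℤₚ.∣-i∣≡∣i∣ i)

parityℤ-minus : ∀ i j → parityℤ (i -ᶻ j) ≡ parityℤ i +ᵖ parityℤ j
parityℤ-minus i j = trans (parityℤ-+ i (-ᶻ j)) (cong (parityℤ i +ᵖ_) (parityℤ-neg j))

sumℤ-even : {f : Fin m → ℤ} → (∀ i → parityℤ (f i) ≡ 0ℙ) → parityℤ (sumℤ f) ≡ 0ℙ
sumℤ-even {zero}      ev = refl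
sumℤ-even {suc m} {f} ev = trans (parityℤ-+ (f zero) _) (cong₂ _+ᵖ_ (ev zero) (sumℤ-even (ev ∘ suc)))

-- Boundaries of integer chains

δ : Maybe (Fin n) → Maybe (Fin n) → ℤ
δ u w = if ⌊ u ≟ᵐ w ⌋ then 1ℤ else 0ℤ

δ-refl : (w : Maybe (Fin n)) → δ w w ≡ 1ℤ
δ-refl w with w ≟ᵐ w
... | yes _  = refl
... | no w≢w = contradiction refl w≢w

δ-≢ : {u w : Maybe (Fin n)} → u ≢ w → δ u w ≡ 0ℤ
δ-≢ {u = u} {w} u≢w with u ≟ᵐ w
... | yes u≡w = contradiction u≡w u≢w
... | no _    = refl

term : (s t : Fin m → Maybe (Fin n)) → (Fin m → ℤ) → Maybe (Fin n) → Fin m → ℤ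
term s t x w e = x e *ᶻ (δ (t e) w -ᶻ δ (s e) w)

-- Inflow minus outflow. All free ends meet at the extra vertex `nothing`, so every edge has two
-- ends; a loop contributes zero.
∂ : (s t : Fin m → Maybe (Fin n)) → (Fin m → ℤ) → Maybe (Fin n) → ℤ
∂ s t x w = sumℤ (term s t x w)

-- ε is the sign that turns the edge into one from b to its other end z.
other-end : (s t b : Maybe (Fin n)) → s ≡ b ⊎ t ≡ b →
  Σ[ z ∈ Maybe (Fin n) ] Σ[ ε ∈ ℤ ] ∣ ε ∣ ≡ 1 ×
    (∀ w → ε *ᶻ (δ t w -ᶻ δ s w) ≡ δ z w -ᶻ δ b w)
other-end s t _ (inj₁ refl) = t , 1ℤ , refl , λ w → ℤₚ.*-identityˡ _
other-end s t _ (inj₂ refl) = s , -1ℤ , refl , λ w → flip (δ t w) (δ s w)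
  where
  flip : ∀ a b → -1ℤ *ᶻ (a -ᶻ b) ≡ b -ᶻ a
  flip = solve-∀

-- If every edge at `b` were even, each term of the boundary at `b` would be even.
incident-odd : (s t : Fin m → Maybe (Fin n)) (x : Fin m → ℤ) (b : Maybe (Fin n)) →
  parityℤ (∂ s t x b) ≡ 1ℙ → Σ[ j ∈ Fin m ] parityℤ (x j) ≡ 1ℙ × (s j ≡ b ⊎ t j ≡ b)
incident-odd s t x b odd
  with any? (λ j → (parityℤ (x j) ℙₚ.≟ 1ℙ) ×-dec ((s j ≟ᵐ b) ⊎-dec (t j ≟ᵐ b)))
... | yes found = found
... | no none = contradiction (trans (sym odd) (sumℤ-even even)) λ ()
  where
  even : ∀ e → parityℤ (term s t x b e) ≡ 0ℙ
  even e with parityℤ (x e) in px | parityℤ-* (x e) (δ (t e) b -ᶻ δ (s e) b)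
  ... | 0ℙ | eq = eq
  ... | 1ℙ | eq rewrite δ-≢ {u = t e} {b} (λ te → none (e , px , inj₂ te))
                      | δ-≢ {u = s e} {b} (λ se → none (e , px , inj₁ se)) = eq

-- The lift is ±1 on the odd edges of `x` and 0 on the even ones, so it is an Eulerian orientation
-- of the odd subgraph.
EvenLift : (s t : Fin m → Maybe (Fin n)) (x : Fin m → ℤ) → Set
EvenLift {m} s t x = Σ[ y ∈ (Fin m → ℤ) ] (∀ e → ∣ y e ∣ ≤ 1) ×
  (∀ e → parityℤ (y e) ≡ parityℤ (x e)) × (∀ w → ∂ s t y w ≡ 0ℤ)

tail-even : (s t : Fin (suc m) → Maybe (Fin n)) (x : Fin (suc m) → ℤ) (w : Maybe (Fin n)) →
  parityℤ (term s t x w zero) ≡ 0ℙ → parityℤ (∂ s t x w) ≡ 0ℙ →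
  parityℤ (∂ (s ∘ suc) (t ∘ suc) (x ∘ suc) w) ≡ 0ℙ
tail-even s t x w head total = trans (cong (_+ᵖ parityℤ (∂ (s ∘ suc) (t ∘ suc) (x ∘ suc) w)) (sym head))
  (trans (sym (parityℤ-+ (term s t x w zero) _)) total)

-- An odd edge that is no loop contributes an odd amount at its target, which the other edges have
-- to balance. `incident-odd` then finds an edge that continues the walk.
tail-odd : (s t : Fin (suc m) → Maybe (Fin n)) (x : Fin (suc m) → ℤ) → s zero ≢ t zero →
  parityℤ (x zero) ≡ 1ℙ → parityℤ (∂ s t x (t zero)) ≡ 0ℙ →
  parityℤ (∂ (s ∘ suc) (t ∘ suc) (x ∘ suc) (t zero)) ≡ 1ℙ
tail-odd s t x s≢t odd total = flip tail-parity (trans (cong (_+ᵖ tail-parity) (sym head))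
  (trans (sym (parityℤ-+ (term s t x (t zero) zero) _)) total))
  where
  tail-parity = parityℤ (∂ (s ∘ suc) (t ∘ suc) (x ∘ suc) (t zero))
  head : parityℤ (term s t x (t zero) zero) ≡ 1ℙ
  head = trans (parityℤ-* (x zero) _) (cong₂ _*ᵖ_ odd
    (cong parityℤ (cong₂ _-ᶻ_ (δ-refl (t zero)) (δ-≢ s≢t))))
  flip : ∀ p → 1ℙ +ᵖ p ≡ 0ℙ → p ≡ 1ℙ
  flip 1ℙ _ = refl

lift-cons : (s t : Fin (suc m) → Maybe (Fin n)) (x : Fin (suc m) → ℤ) (y₀ : ℤ) → ∣ y₀ ∣ ≤ 1 →
  parityℤ y₀ ≡ parityℤ (x zero) → (∀ w → y₀ *ᶻ (δ (t zero) w -ᶻ δ (s zero) w) ≡ 0ℤ) →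
  EvenLift (s ∘ suc) (t ∘ suc) (x ∘ suc) → EvenLift s t x
lift-cons s t x y₀ small par cyc (y , small′ , par′ , cyc′) =
  (λ { zero → y₀ ; (suc e) → y e }) ,
  (λ { zero → small ; (suc e) → small′ e }) ,
  (λ { zero → par ; (suc e) → par′ e }) ,
  (λ w → cong₂ _+ᶻ_ (cyc w) (cyc′ w))

-- By `reads`, the edge `suc j` taken with sign `ε` runs from `t zero` to `z`. The edges `zero` and
-- `suc j` become one edge from `s zero` to `z`, stored at position `j`.
module Splice (s t : Fin (suc m) → Maybe (Fin n)) (x : Fin (suc m) → ℤ)
  (j : Fin m) (z : Maybe (Fin n)) (ε : ℤ) (unit : ∣ ε ∣ ≡ 1)
  (reads : ∀ w → ε *ᶻ (δ (t (suc j)) w -ᶻ δ (s (suc j)) w) ≡ δ z w -ᶻ δ (t zero) w)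
  (odd₀ : parityℤ (x zero) ≡ 1ℙ) (oddⱼ : parityℤ (x (suc j)) ≡ 1ℙ) where

  s′ t′ : Fin m → Maybe (Fin n)
  s′ = updateAt (s ∘ suc) j (const (s zero))
  t′ = updateAt (t ∘ suc) j (const z)

  parity-ε : ∀ i → parityℤ (ε *ᶻ i) ≡ parityℤ i
  parity-ε i = trans (parityℤ-* ε i) (cong (λ k → parity k *ᵖ parityℤ i) unit)

  term′-≢ : (y : Fin m → ℤ) (w : Maybe (Fin n)) → ∀ e → e ≢ j →
    term s′ t′ y w e ≡ term (s ∘ suc) (t ∘ suc) y w e
  term′-≢ y w e e≢j = cong₂ (λ p q → y e *ᶻ (δ p w -ᶻ δ q w))
    (updateAt-minimal e j (t ∘ suc) e≢j) (updateAt-minimal e j (s ∘ suc) e≢j)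

  term′-≡ : (y : Fin m → ℤ) (w : Maybe (Fin n)) →
    term s′ t′ y w j ≡ y j *ᶻ (δ z w -ᶻ δ (s zero) w)
  term′-≡ y w = cong₂ (λ p q → y j *ᶻ (δ p w -ᶻ δ q w))
    (updateAt-updates j (t ∘ suc)) (updateAt-updates j (s ∘ suc))

  parity-odd-* : ∀ {i} (a b : ℤ) → parityℤ i ≡ 1ℙ → parityℤ (i *ᶻ (a -ᶻ b)) ≡ parityℤ a +ᵖ parityℤ b
  parity-odd-* {i} a b odd = trans (parityℤ-* i (a -ᶻ b))
    (trans (cong (_*ᵖ parityℤ (a -ᶻ b)) odd) (parityℤ-minus a b))

  -- Mod 2 the two edges of the path have the boundary of the spliced edge, since the middle vertex
  -- occurs twice.
  spliced-even : ∀ w → parityℤ (∂ s t x w) ≡ 0ℙ → parityℤ (∂ s′ t′ (x ∘ suc) w) ≡ 0ℙ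
  spliced-even w ev = combine (parityℤ (δ (s zero) w)) (parityℤ (δ (t zero) w)) (parityℤ (δ z w))
    (tail-parity) (parityℤ (∂ s′ t′ (x ∘ suc) w))
    (trans (cong (_+ᵖ tail-parity) (sym (parity-odd-* {x zero} (δ (t zero) w) (δ (s zero) w) odd₀)))
      (trans (sym (parityℤ-+ (term s t x w zero) _)) ev))
    (begin
      parityℤ (∂ s′ t′ (x ∘ suc) w) +ᵖ (parityℤ (δ z w) +ᵖ parityℤ (δ (t zero) w))
        ≡⟨ cong (parityℤ (∂ s′ t′ (x ∘ suc) w) +ᵖ_) head-j ⟨
      parityℤ (∂ s′ t′ (x ∘ suc) w) +ᵖ parityℤ (term s t x w (suc j))
        ≡⟨ parityℤ-+ (∂ s′ t′ (x ∘ suc) w) _ ⟨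
      parityℤ (∂ s′ t′ (x ∘ suc) w +ᶻ term s t x w (suc j))
        ≡⟨ cong parityℤ (sumℤ-update (term s′ t′ (x ∘ suc) w) (term s t x w ∘ suc) j (term′-≢ (x ∘ suc) w)) ⟩
      parityℤ (∂ (s ∘ suc) (t ∘ suc) (x ∘ suc) w +ᶻ term s′ t′ (x ∘ suc) w j)
        ≡⟨ parityℤ-+ (∂ (s ∘ suc) (t ∘ suc) (x ∘ suc) w) _ ⟩
      tail-parity +ᵖ parityℤ (term s′ t′ (x ∘ suc) w j)
        ≡⟨ cong (tail-parity +ᵖ_) (trans (cong parityℤ (term′-≡ (x ∘ suc) w))
             (parity-odd-* {x (suc j)} (δ z w) (δ (s zero) w) oddⱼ)) ⟩
      tail-parity +ᵖ (parityℤ (δ z w) +ᵖ parityℤ (δ (s zero) w)) ∎)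
    where
    open ≡-Reasoning
    tail-parity = parityℤ (∂ (s ∘ suc) (t ∘ suc) (x ∘ suc) w)
    head-j : parityℤ (term s t x w (suc j)) ≡ parityℤ (δ z w) +ᵖ parityℤ (δ (t zero) w)
    head-j = trans (parityℤ-* (x (suc j)) _) (trans (cong (_*ᵖ _) oddⱼ)
      (trans (sym (parity-ε _)) (trans (cong parityℤ (reads w)) (parityℤ-minus (δ z w) (δ (t zero) w)))))
    -- `a`, `b`, `c` are the parities of the deltas at start, middle and far end, `d` that of the
    -- boundary without the first edge, `e` that of the spliced boundary. The first equation forces
    -- `d` to be the sum of `a` and `b`, and for odd `e` the second then fails.
    combine : ∀ a b c d e → (b +ᵖ a) +ᵖ d ≡ 0ℙ → e +ᵖ (c +ᵖ b) ≡ d +ᵖ (c +ᵖ a) → e ≡ 0ℙ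
    combine _  _  _  _  0ℙ _ _ = refl
    combine 0ℙ 0ℙ 0ℙ 0ℙ 1ℙ _ ()
    combine 0ℙ 0ℙ 1ℙ 0ℙ 1ℙ _ ()
    combine 0ℙ 1ℙ 0ℙ 1ℙ 1ℙ _ ()
    combine 0ℙ 1ℙ 1ℙ 1ℙ 1ℙ _ ()
    combine 1ℙ 0ℙ 0ℙ 1ℙ 1ℙ _ ()
    combine 1ℙ 0ℙ 1ℙ 1ℙ 1ℙ _ ()
    combine 1ℙ 1ℙ 0ℙ 0ℙ 1ℙ _ ()
    combine 1ℙ 1ℙ 1ℙ 0ℙ 1ℙ _ ()

  -- The value on the spliced edge is sent along both original edges, with the sign `ε` on the
  -- second, so that it passes through the middle vertex without loss.
  unsplice : EvenLift s′ t′ (x ∘ suc) → EvenLift s t x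
  unsplice (y , small , par , cyc) = y⁺ , small⁺ , par⁺ , cyc⁺
    where
    y₁ : Fin m → ℤ
    y₁ = updateAt y j (ε *ᶻ_)
    y⁺ : Fin (suc m) → ℤ
    y⁺ zero = y j
    y⁺ (suc e) = y₁ e
    small⁺ : ∀ e → ∣ y⁺ e ∣ ≤ 1
    small⁺ zero = small j
    small⁺ (suc e) with e ≟ᶠ j
    ... | yes refl = subst (_≤ 1) (sym (trans (cong ∣_∣ (updateAt-updates j y))
            (trans (ℤₚ.abs-* ε (y j)) (trans (cong (ℕ._* ∣ y j ∣) unit) (ℕₚ.*-identityˡ _))))) (small j)
    ... | no e≢j = subst (_≤ 1) (sym (cong ∣_∣ (updateAt-minimal e j y e≢j))) (small e)
    par⁺ : ∀ e → parityℤ (y⁺ e) ≡ parityℤ (x e)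
    par⁺ zero = trans (par j) (trans oddⱼ (sym odd₀))
    par⁺ (suc e) with e ≟ᶠ j
    ... | yes refl = trans (cong parityℤ (updateAt-updates j y)) (trans (parity-ε (y j)) (par j))
    ... | no e≢j = trans (cong parityℤ (updateAt-minimal e j y e≢j)) (par e)
    term-≢ : ∀ w e → e ≢ j → term s′ t′ y w e ≡ term (s ∘ suc) (t ∘ suc) y₁ w e
    term-≢ w e e≢j = trans (term′-≢ y w e e≢j)
      (cong (_*ᶻ _) (sym (updateAt-minimal e j y e≢j)))
    term-j : ∀ w → term (s ∘ suc) (t ∘ suc) y₁ w j ≡ y j *ᶻ (δ z w -ᶻ δ (t zero) w)
    term-j w = trans (cong (_*ᶻ _) (updateAt-updates j y))
      (trans (reassoc ε (y j) _) (cong (y j *ᶻ_) (reads w)))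
      where
      reassoc : ∀ a b c → (a *ᶻ b) *ᶻ c ≡ b *ᶻ (a *ᶻ c)
      reassoc = solve-∀
    -- `a`, `b`, `c` are the deltas of start, middle and far end, and `S` includes the edge from
    -- middle to far end. Exchanging that edge for the spliced one gives boundary zero, so the edge
    -- from start to middle makes up the difference.
    cancel : ∀ k a b c S → 0ℤ +ᶻ k *ᶻ (c -ᶻ b) ≡ S +ᶻ k *ᶻ (c -ᶻ a) → k *ᶻ (b -ᶻ a) +ᶻ S ≡ 0ℤ
    cancel k a b c S eq = trans (left k a b c S) (trans (cong (_-ᶻ k *ᶻ (c -ᶻ b)) (sym eq)) (right (k *ᶻ (c -ᶻ b))))
      where
      left : ∀ k a b c S → k *ᶻ (b -ᶻ a) +ᶻ S ≡ (S +ᶻ k *ᶻ (c -ᶻ a)) -ᶻ k *ᶻ (c -ᶻ b)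
      left = solve-∀
      right : ∀ i → (0ℤ +ᶻ i) -ᶻ i ≡ 0ℤ
      right = solve-∀
    cyc⁺ : ∀ w → ∂ s t y⁺ w ≡ 0ℤ
    cyc⁺ w = cancel (y j) (δ (s zero) w) (δ (t zero) w) (δ z w) (∂ (s ∘ suc) (t ∘ suc) y₁ w)
      (trans (cong₂ _+ᶻ_ (sym (cyc w)) (sym (term-j w)))
      (trans (sumℤ-update (term s′ t′ y w) (term (s ∘ suc) (t ∘ suc) y₁ w) j (term-≢ w))
      (cong (∂ (s ∘ suc) (t ∘ suc) y₁ w +ᶻ_) (term′-≡ y w))))

-- Eulerian orientations: an odd edge from a to b is spliced with another odd edge at b
-- into a single edge leaving a, which lowers the number of edges.
even-boundary⇒cycle : (s t : Fin m → Maybe (Fin n)) (x : Fin m → ℤ) →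
  (∀ w → parityℤ (∂ s t x w) ≡ 0ℙ) → EvenLift s t x
even-boundary⇒cycle {zero}  s t x ev = x , (λ ()) , (λ ()) , (λ _ → refl)
even-boundary⇒cycle {suc m} {n} s t x ev with parityℤ (x zero) in px | s zero ≟ᵐ t zero
... | 0ℙ | _ = lift-cons s t x 0ℤ z≤n (sym px) (λ _ → refl)
    (even-boundary⇒cycle (s ∘ suc) (t ∘ suc) (x ∘ suc) λ w → tail-even s t x w (head w) (ev w))
  where
  head : ∀ w → parityℤ (term s t x w zero) ≡ 0ℙ
  head w = trans (parityℤ-* (x zero) _) (cong (_*ᵖ _) px)
-- An odd loop, or an edge with two free ends, has zero boundary and may take either sign.
... | 1ℙ | yes s≡t = lift-cons s t x 1ℤ (s≤s z≤n) (sym px)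
    (λ w → trans (ℤₚ.*-identityˡ _) (loop w))
    (even-boundary⇒cycle (s ∘ suc) (t ∘ suc) (x ∘ suc) λ w → tail-even s t x w (head w) (ev w))
  where
  loop : ∀ w → δ (t zero) w -ᶻ δ (s zero) w ≡ 0ℤ
  loop w rewrite s≡t = ℤₚ.+-inverseʳ (δ (t zero) w)
  head : ∀ w → parityℤ (term s t x w zero) ≡ 0ℙ
  head w = trans (parityℤ-* (x zero) _) (cong₂ (λ p i → p *ᵖ parityℤ i) px (loop w))
... | 1ℙ | no s≢t
  with j , oddⱼ , at-b ← incident-odd (s ∘ suc) (t ∘ suc) (x ∘ suc) (t zero) (tail-odd s t x s≢t px (ev (t zero)))
  with z , ε , unit , reads ← other-end (s (suc j)) (t (suc j)) (t zero) at-b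
  = unsplice (even-boundary⇒cycle s′ t′ (x ∘ suc) λ w → spliced-even w (ev w))
  where
  open Splice s t x j z ε unit reads px oddⱼ

-- Natural sums

sumℕ-cong : {f g : Fin m → ℕ} → (∀ i → f i ≡ g i) → sumℕ f ≡ sumℕ g
sumℕ-cong {zero}  eq = refl
sumℕ-cong {suc m} eq = cong₂ _+_ (eq zero) (sumℕ-cong (eq ∘ suc))

sumℕ-+ : (f g : Fin m → ℕ) → sumℕ (λ i → f i + g i) ≡ sumℕ f + sumℕ g
sumℕ-+ {zero}  f g = refl
sumℕ-+ {suc m} f g = trans (cong (f zero + g zero +_) (sumℕ-+ (f ∘ suc) (g ∘ suc)))
  (interchange (f zero) (g zero) _ _)

≤-sumℕ : (f : Fin m → ℕ) (i : Fin m) → f i ≤ sumℕ f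
≤-sumℕ f zero    = ℕₚ.m≤m+n (f zero) _
≤-sumℕ f (suc i) = ℕₚ.≤-trans (≤-sumℕ (f ∘ suc) i) (ℕₚ.m≤n+m _ (f zero))

sumℕ-mono : {f g : Fin m → ℕ} → (∀ i → f i ≤ g i) → sumℕ f ≤ sumℕ g
sumℕ-mono {zero}  le = z≤n
sumℕ-mono {suc m} le = ℕₚ.+-mono-≤ (le zero) (sumℕ-mono (le ∘ suc))

sumℕ-pos : (f : Fin m → ℕ) → 0 < sumℕ f → Σ[ i ∈ Fin m ] 0 < f i
sumℕ-pos {suc m} f pos with f zero in eq
... | suc k = zero , subst (0 <_) (sym eq) (s≤s z≤n)
... | zero with i , p ← sumℕ-pos (f ∘ suc) pos = suc i , p

sumℕ-≤1 : (f : Fin m → ℕ) → (∀ i → f i ≤ 1) → (∀ i j → 0 < f i → 0 < f j → i ≡ j) → sumℕ f ≤ 1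
sumℕ-≤1 {zero}  f small uniq = z≤n
sumℕ-≤1 {suc m} f small uniq with f zero in eq₀ | sumℕ (f ∘ suc) in eq
... | zero  | _ = subst (_≤ 1) eq
  (sumℕ-≤1 (f ∘ suc) (small ∘ suc) λ i j p q → suc-inj (uniq (suc i) (suc j) p q))
  where
  suc-inj : {i j : Fin m} → suc i ≡ suc j → i ≡ j
  suc-inj refl = refl
... | suc k | zero = subst (_≤ 1) (trans eq₀ (sym (ℕₚ.+-identityʳ (suc k)))) (small zero)
... | suc k | suc l with i , p ← sumℕ-pos (f ∘ suc) (subst (0 <_) (sym eq) (s≤s z≤n)) =
  contradiction (uniq zero (suc i) (subst (0 <_) (sym eq₀) (s≤s z≤n)) p) λ ()

sumℕ-≤1-unique : (f : Fin m → ℕ) → sumℕ f ≤ 1 → ∀ i j → 0 < f i → 0 < f j → i ≡ j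
sumℕ-≤1-unique f le zero zero p q = refl
sumℕ-≤1-unique f le zero (suc j) p q = contradiction
  (ℕₚ.≤-trans (ℕₚ.+-mono-≤ p (ℕₚ.≤-trans q (≤-sumℕ (f ∘ suc) j))) le) λ { (s≤s ()) }
sumℕ-≤1-unique f le (suc i) zero p q = sym (sumℕ-≤1-unique f le zero (suc i) q p)
sumℕ-≤1-unique f le (suc i) (suc j) p q =
  cong suc (sumℕ-≤1-unique (f ∘ suc) (ℕₚ.≤-trans (ℕₚ.m≤n+m _ (f zero)) le) i j p q)

parity-sum : (f : Fin m → ℕ) (g : Fin m → ℤ) → (∀ i → parity (f i) ≡ parityℤ (g i)) →
  parity (sumℕ f) ≡ parityℤ (sumℤ g)
parity-sum {zero}  f g eq = refl
parity-sum {suc m} f g eq = trans (ℙₚ.+-homo-+ (f zero) _)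
  (trans (cong₂ _+ᵖ_ (eq zero) (parity-sum (f ∘ suc) (g ∘ suc) (eq ∘ suc))) (sym (parityℤ-+ (g zero) _)))

-- Weighted degrees

atEnd : Maybe (Fin n) → Maybe (Fin n) → ℕ → ℕ
atEnd x w k = if ⌊ x ≟ᵐ w ⌋ then k else 0

-- Spelled so that the weight of `const 1` at a vertex is `deg` by definition; loops count twice.
weight : (Fin m → Fin 2 → Maybe (Fin n)) → Maybe (Fin n) → (Fin m → ℕ) → ℕ
weight E w g = sumℕ λ e → sumℕ λ i → atEnd (E e i) w (g e)

atEnd-+ : (x w : Maybe (Fin n)) (k l : ℕ) → atEnd x w (k + l) ≡ atEnd x w k + atEnd x w l
atEnd-+ x w k l with x ≟ᵐ w
... | yes _ = refl
... | no _  = refl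

atEnd-≤ : (x w : Maybe (Fin n)) (k : ℕ) → atEnd x w k ≤ k
atEnd-≤ x w k with x ≟ᵐ w
... | yes _ = ℕₚ.≤-refl
... | no _  = z≤n

atEnd-≡ : {x w : Maybe (Fin n)} (k : ℕ) → x ≡ w → atEnd x w k ≡ k
atEnd-≡ {x = x} {w} k eq with x ≟ᵐ w
... | yes _ = refl
... | no ne = contradiction eq ne

atEnd-pos : (x w : Maybe (Fin n)) (k : ℕ) → 0 < atEnd x w k → x ≡ w × 0 < k
atEnd-pos x w k pos with x ≟ᵐ w
... | yes eq = eq , pos

parity-atEnd : (x w : Maybe (Fin n)) (k : ℕ) → parity (atEnd x w k) ≡ parity k *ᵖ parityℤ (δ x w)
parity-atEnd x w k with x ≟ᵐ w
... | yes _ = sym (ℙₚ.*-identityʳ (parity k))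
... | no _  = sym (ℙₚ.*-zeroʳ (parity k))

atEnd-cong : {l : ℕ} {x w : Maybe (Fin n)} {y z : Maybe (Fin l)} (k : ℕ) →
  (x ≡ w → y ≡ z) → (y ≡ z → x ≡ w) → atEnd x w k ≡ atEnd y z k
atEnd-cong {x = x} {w} {y} {z} k to from with x ≟ᵐ w | y ≟ᵐ z
... | yes _ | yes _ = refl
... | no _  | no _  = refl
... | yes p | no ¬q = contradiction (to p) ¬q
... | no ¬p | yes q = contradiction (from q) ¬p

weight-transport : {l : ℕ} (E : Fin m → Fin 2 → Maybe (Fin n)) (E′ : Fin m → Fin 2 → Maybe (Fin l))
  {w : Maybe (Fin n)} {w′ : Maybe (Fin l)} (g : Fin m → ℕ) →
  (∀ e i → E e i ≡ w → E′ e i ≡ w′) → (∀ e i → E′ e i ≡ w′ → E e i ≡ w) →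
  weight E w g ≡ weight E′ w′ g
weight-transport E E′ g to from =
  sumℕ-cong λ e → sumℕ-cong λ i → atEnd-cong (g e) (to e i) (from e i)

weight-+ : (E : Fin m → Fin 2 → Maybe (Fin n)) (w : Maybe (Fin n)) (g h : Fin m → ℕ) →
  weight E w (λ e → g e + h e) ≡ weight E w g + weight E w h
weight-+ E w g h = trans (sumℕ-cong λ e →
    trans (sumℕ-cong λ i → atEnd-+ (E e i) w (g e) (h e))
          (sumℕ-+ (λ i → atEnd (E e i) w (g e)) (λ i → atEnd (E e i) w (h e))))
  (sumℕ-+ (λ e → sumℕ λ i → atEnd (E e i) w (g e)) (λ e → sumℕ λ i → atEnd (E e i) w (h e)))

weight-cong : (E : Fin m → Fin 2 → Maybe (Fin n)) (w : Maybe (Fin n)) {g h : Fin m → ℕ} →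
  (∀ e → g e ≡ h e) → weight E w g ≡ weight E w h
weight-cong E w eq = sumℕ-cong λ e → sumℕ-cong λ i → cong (atEnd (E e i) w) (eq e)

module _ (E : Fin m → Fin 2 → Maybe (Fin n)) where

  source target : Fin m → Maybe (Fin n)
  source e = E e zero
  target e = E e (suc zero)

  -- Mod 2 the sign that tells head from tail disappears. This translates between colour counts at a
  -- vertex and boundaries of chains.
  parity-weight : (w : Maybe (Fin n)) (g : Fin m → ℕ) (x : Fin m → ℤ) →
    (∀ e → parity (g e) ≡ parityℤ (x e)) → parity (weight E w g) ≡ parityℤ (∂ source target x w)
  parity-weight w g x eq = parity-sum _ (term source target x w) λ e → begin
    parity (sumℕ λ i → atEnd (E e i) w (g e))
      ≡⟨ cong (λ k → parity (atEnd (E e zero) w (g e) + k)) (ℕₚ.+-identityʳ _) ⟩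
    parity (atEnd (E e zero) w (g e) + atEnd (E e (suc zero)) w (g e))
      ≡⟨ ℙₚ.+-homo-+ (atEnd (E e zero) w (g e)) _ ⟩
    parity (atEnd (E e zero) w (g e)) +ᵖ parity (atEnd (E e (suc zero)) w (g e))
      ≡⟨ cong₂ _+ᵖ_ (parity-atEnd (E e zero) w (g e)) (parity-atEnd (E e (suc zero)) w (g e)) ⟩
    (parity (g e) *ᵖ parityℤ (δ (E e zero) w)) +ᵖ (parity (g e) *ᵖ parityℤ (δ (E e (suc zero)) w))
      ≡⟨ ℙₚ.*-distribˡ-+ (parity (g e)) (parityℤ (δ (E e zero) w)) (parityℤ (δ (E e (suc zero)) w)) ⟨
    parity (g e) *ᵖ (parityℤ (δ (E e zero) w) +ᵖ parityℤ (δ (E e (suc zero)) w))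
      ≡⟨ cong (parity (g e) *ᵖ_) (ℙₚ.+-comm (parityℤ (δ (E e zero) w)) (parityℤ (δ (E e (suc zero)) w))) ⟩
    parity (g e) *ᵖ (parityℤ (δ (E e (suc zero)) w) +ᵖ parityℤ (δ (E e zero) w))
      ≡⟨ cong₂ _*ᵖ_ (eq e) (sym (parityℤ-minus (δ (E e (suc zero)) w) (δ (E e zero) w))) ⟩
    parityℤ (x e) *ᵖ parityℤ (δ (E e (suc zero)) w -ᶻ δ (E e zero) w)
      ≡⟨ parityℤ-* (x e) _ ⟨
    parityℤ (term source target x w e) ∎
    where open ≡-Reasoning

  weight-≤1 : (w : Maybe (Fin n)) (g : Fin m → ℕ) → (∀ e → g e ≤ 1) →
    (∀ e i e′ i′ → E e i ≡ w → E e′ i′ ≡ w → 0 < g e → 0 < g e′ → (e , i) ≡ (e′ , i′)) →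
    weight E w g ≤ 1
  weight-≤1 w g small uniq = sumℕ-≤1 _
    (λ e → sumℕ-≤1 _ (λ i → ℕₚ.≤-trans (atEnd-≤ (E e i) w (g e)) (small e))
       λ i j p q → case-unique e i e j p q λ { refl → refl })
    λ e e′ p q →
      let i , p′ = sumℕ-pos (λ i → atEnd (E e i) w (g e)) p
          j , q′ = sumℕ-pos (λ i → atEnd (E e′ i) w (g e′)) q in
       case-unique e i e′ j p′ q′ (cong proj₁)
    where
    case-unique : ∀ {A : Set} e i e′ i′ → 0 < atEnd (E e i) w (g e) → 0 < atEnd (E e′ i′) w (g e′) →
      ((e , i) ≡ (e′ , i′) → A) → A
    case-unique e i e′ i′ p q k with eq , pos ← atEnd-pos (E e i) w (g e) p
      with eq′ , pos′ ← atEnd-pos (E e′ i′) w (g e′) q = k (uniq e i e′ i′ eq eq′ pos pos′)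

  edgeWeight : Maybe (Fin n) → (Fin m → ℕ) → Fin m → ℕ
  edgeWeight w g e = sumℕ λ i → atEnd (E e i) w (g e)

  edgeWeight-pos : ∀ {w g} e i → E e i ≡ w → 0 < g e → 0 < edgeWeight w g e
  edgeWeight-pos {w} {g} e i p pos = ℕₚ.≤-trans (subst (0 <_) (sym (atEnd-≡ (g e) p)) pos)
    (≤-sumℕ (λ i → atEnd (E e i) w (g e)) i)

  weight-≤1-unique : (w : Maybe (Fin n)) (g : Fin m → ℕ) → weight E w g ≤ 1 →
    ∀ e i e′ i′ → E e i ≡ w → E e′ i′ ≡ w → 0 < g e → 0 < g e′ → (e , i) ≡ (e′ , i′)
  weight-≤1-unique w g le e i e′ i′ p q pos pos′
    with refl ← sumℕ-≤1-unique (edgeWeight w g) le e e′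
      (edgeWeight-pos {w} {g} e i p pos) (edgeWeight-pos {w} {g} e′ i′ q pos′)
    = cong (e ,_) (sumℕ-≤1-unique _ (ℕₚ.≤-trans (≤-sumℕ (edgeWeight w g) e) le) i i′
        (subst (0 <_) (sym (atEnd-≡ (g e) p)) pos) (subst (0 <_) (sym (atEnd-≡ (g e) q)) pos′))

-- Colours as the nonzero elements of ℤ₂ × ℤ₂

indicator : Fin 3 → Fin 3 → ℕ
indicator k l = if ⌊ l ≟ᶠ k ⌋ then 1 else 0

red green blue : Fin 3
red   = zero
green = suc zero
blue  = suc (suc zero)

-- The coordinates of red = (1,0), green = (0,1) and blue = (1,1). As sums of indicators they split
-- under `weight-+` into sizes of colour classes.
bit₁ bit₂ : Fin 3 → ℕ
bit₁ k = indicator red k + indicator blue k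
bit₂ k = indicator green k + indicator blue k

indicator-≤1 : ∀ k l → indicator k l ≤ 1
indicator-≤1 k l with l ≟ᶠ k
... | yes _ = s≤s z≤n
... | no _  = z≤n

indicator-pos : ∀ k l → 0 < indicator k l → l ≡ k
indicator-pos k l pos with l ≟ᶠ k
... | yes eq = eq

indicator-refl : ∀ k → 0 < indicator k k
indicator-refl k with k ≟ᶠ k
... | yes _  = s≤s z≤n
... | no k≢k = contradiction refl k≢k

all-indicators : ∀ l → 1 ≡ (indicator red l + indicator green l) + indicator blue l
all-indicators zero = refl
all-indicators (suc zero) = refl
all-indicators (suc (suc zero)) = refl

colour : Parity → Parity → Fin 3
colour 1ℙ 0ℙ = red
-- This includes the default for (0,0), a pair that the hypothesis of `colour-bits` rules out.
colour 0ℙ _  = green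
colour 1ℙ 1ℙ = blue

colour-bits : ∀ p q → p ≡ 1ℙ ⊎ q ≡ 1ℙ → parity (bit₁ (colour p q)) ≡ p × parity (bit₂ (colour p q)) ≡ q
colour-bits 0ℙ 1ℙ _ = refl , refl
colour-bits 1ℙ 0ℙ _ = refl , refl
colour-bits 1ℙ 1ℙ _ = refl , refl
colour-bits 0ℙ 0ℙ (inj₁ ())
colour-bits 0ℙ 0ℙ (inj₂ ())

bits-odd : ∀ k → parity (bit₁ k) ≡ 1ℙ ⊎ parity (bit₂ k) ≡ 1ℙ
bits-odd zero = inj₁ refl
bits-odd (suc zero) = inj₂ refl
bits-odd (suc (suc zero)) = inj₁ refl

three-≤1 : ∀ {x y z} → x ≤ 1 → y ≤ 1 → z ≤ 1 → (x + y) + z ≡ 3 → x ≡ 1 × y ≡ 1 × z ≡ 1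
three-≤1 (s≤s z≤n) (s≤s z≤n) (s≤s z≤n) _ = refl , refl , refl
three-≤1 (s≤s z≤n) (s≤s z≤n) z≤n ()
three-≤1 (s≤s z≤n) z≤n (s≤s z≤n) ()
three-≤1 (s≤s z≤n) z≤n z≤n ()
three-≤1 z≤n (s≤s z≤n) (s≤s z≤n) ()
three-≤1 z≤n (s≤s z≤n) z≤n ()
three-≤1 z≤n z≤n (s≤s z≤n) ()
three-≤1 z≤n z≤n z≤n ()

-- The two conditions give `x`, `y`, `z` the same parity. Their sum is odd, so all three are odd and
-- hence at least 1, which leaves only 1 each.
three-even : ∀ x y z → (x + y) + z ≡ 3 → parity (x + z) ≡ 0ℙ → parity (y + z) ≡ 0ℙ →
  x ≡ 1 × y ≡ 1 × z ≡ 1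
three-even 0 0 .3 refl () _
three-even 0 1 .2 refl _ ()
three-even 0 2 .1 refl () _
three-even 0 3 .0 refl _ ()
three-even 1 0 .2 refl () _
three-even 1 1 .1 refl _ _ = refl , refl , refl
three-even 1 2 .0 refl () _
three-even 2 0 .1 refl () _
three-even 2 1 .0 refl _ ()
three-even 3 0 .0 refl () _

module _ (E : Fin m → Fin 2 → Maybe (Fin n)) (c : Fin m → Fin 3) (w : Maybe (Fin n)) where

  ProperAt : Set
  ProperAt = ∀ e i e′ i′ → (e , i) ≢ (e′ , i′) → E e i ≡ w → E e′ i′ ≡ w → c e ≢ c e′

  -- Kirchhoff's law over ℤ₂ × ℤ₂, one coordinate at a time.
  KleinAt : Set
  KleinAt = parity (weight E w (bit₁ ∘ c)) ≡ 0ℙ × parity (weight E w (bit₂ ∘ c)) ≡ 0ℙ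

  class : Fin 3 → ℕ
  class k = weight E w (indicator k ∘ c)

  class-sum : weight E w (const 1) ≡ (class red + class green) + class blue
  class-sum = trans (weight-cong E w (all-indicators ∘ c))
    (trans (weight-+ E w (λ e → indicator red (c e) + indicator green (c e)) (indicator blue ∘ c))
      (cong (_+ class blue) (weight-+ E w (indicator red ∘ c) (indicator green ∘ c))))

  proper⇒class≤1 : ProperAt → ∀ k → class k ≤ 1
  proper⇒class≤1 proper k = weight-≤1 E w (indicator k ∘ c) (indicator-≤1 k ∘ c)
    λ e i e′ i′ p q pos pos′ → decidable-stable (×-≡-dec _≟ᶠ_ _≟ᶠ_ (e , i) (e′ , i′)) λ ne →
      proper e i e′ i′ ne p q (trans (indicator-pos k (c e) pos) (sym (indicator-pos k (c e′) pos′)))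

  class≤1⇒proper : (∀ k → class k ≤ 1) → ProperAt
  class≤1⇒proper small e i e′ i′ ne p q eq = ne (weight-≤1-unique E w (indicator (c e) ∘ c)
    (small (c e)) e i e′ i′ p q (indicator-refl (c e)) (subst (λ k → 0 < indicator (c e) k) eq (indicator-refl (c e))))

  -- Three classes of size at most 1 with total 3 all have size 1, and each bit is carried by
  -- exactly two colours.
  proper⇒klein : weight E w (const 1) ≡ 3 → ProperAt → KleinAt
  proper⇒klein deg3 proper
    with r , g , b ← three-≤1 (proper⇒class≤1 proper red) (proper⇒class≤1 proper green) (proper⇒class≤1 proper blue) (trans (sym class-sum) deg3)
    = even red blue r b , even green blue g b
    where
    even : ∀ k l → class k ≡ 1 → class l ≡ 1 →
      parity (weight E w (λ e → indicator k (c e) + indicator l (c e))) ≡ 0ℙ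
    even k l p q = cong parity (trans (weight-+ E w (indicator k ∘ c) (indicator l ∘ c)) (cong₂ _+_ p q))

  klein⇒proper : weight E w (const 1) ≡ 3 → KleinAt → ProperAt
  klein⇒proper deg3 (even₁ , even₂)
    with r , g , b ← three-even (class red) (class green) (class blue) (trans (sym class-sum) deg3)
           (trans (cong parity (sym (weight-+ E w (indicator red ∘ c) (indicator blue ∘ c)))) even₁)
           (trans (cong parity (sym (weight-+ E w (indicator green ∘ c) (indicator blue ∘ c)))) even₂)
    = class≤1⇒proper λ { zero → ℕₚ.≤-reflexive r ; (suc zero) → ℕₚ.≤-reflexive g
                       ; (suc (suc zero)) → ℕₚ.≤-reflexive b }

-- Sums over all vertices

sumℤ-δ : (a : Fin n) → sumℤ (λ v → δ (just a) (just v)) ≡ 1ℤ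
sumℤ-δ {n} a = begin
  sumℤ (λ v → δ (just a) (just v))         ≡⟨ ℤₚ.+-identityʳ _ ⟨
  sumℤ (λ v → δ (just a) (just v)) +ᶻ 0ℤ   ≡⟨ sumℤ-update (λ v → δ (just a) (just v)) (λ _ → 0ℤ) a
                                                (λ v v≢a → δ-≢ λ { refl → v≢a refl }) ⟩
  sumℤ {n} (λ _ → 0ℤ) +ᶻ δ (just a) (just a) ≡⟨ cong₂ _+ᶻ_ (sumℤ-zero {n} {λ _ → 0ℤ} λ _ → refl) (δ-refl (just a)) ⟩
  1ℤ ∎
  where open ≡-Reasoning

sumℤ-δ-minus : (a b : Fin n) → sumℤ (λ v → δ (just b) (just v) -ᶻ δ (just a) (just v)) ≡ 0ℤ
sumℤ-δ-minus {n} a b = begin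
  sumℤ (λ v → δb v -ᶻ δa v)             ≡⟨ sumℤ-+ δb (λ v → -ᶻ δa v) ⟩
  sumℤ δb +ᶻ sumℤ (λ v → -ᶻ δa v)       ≡⟨ cong (sumℤ δb +ᶻ_) (sumℤ-cong (λ v → ℤₚ.-1*i≡-i (δa v))) ⟨
  sumℤ δb +ᶻ sumℤ (λ v → -1ℤ *ᶻ δa v)   ≡⟨ cong (sumℤ δb +ᶻ_) (sumℤ-* -1ℤ δa) ⟩
  sumℤ δb +ᶻ -1ℤ *ᶻ sumℤ δa             ≡⟨ cong₂ (λ i j → i +ᶻ -1ℤ *ᶻ j) (sumℤ-δ b) (sumℤ-δ a) ⟩
  0ℤ                                    ∎
  where
  open ≡-Reasoning
  δa δb : Fin n → ℤ
  δa v = δ (just a) (just v)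
  δb v = δ (just b) (just v)

even-elsewhere : (f : Fin n → ℤ) (p : Fin n) → parityℤ (sumℤ f) ≡ 0ℙ →
  (∀ v → v ≢ p → parityℤ (f v) ≡ 0ℙ) → parityℤ (f p) ≡ 0ℙ
even-elsewhere f p total others = begin
  parityℤ (f p)                        ≡⟨ cong (_+ᵖ parityℤ (f p)) (sumℤ-even g-even) ⟨
  parityℤ (sumℤ g) +ᵖ parityℤ (f p)    ≡⟨ parityℤ-+ (sumℤ g) (f p) ⟨
  parityℤ (sumℤ g +ᶻ f p)              ≡⟨ cong parityℤ (sumℤ-update f g p λ v v≢p → sym (updateAt-minimal v p f v≢p)) ⟨
  parityℤ (sumℤ f +ᶻ g p)              ≡⟨ parityℤ-+ (sumℤ f) (g p) ⟩
  parityℤ (sumℤ f) +ᵖ parityℤ (g p)    ≡⟨ cong₂ _+ᵖ_ total (cong parityℤ (updateAt-updates p f)) ⟩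
  0ℙ ∎
  where
  open ≡-Reasoning
  g = updateAt f p (const 0ℤ)
  g-even : ∀ v → parityℤ (g v) ≡ 0ℙ
  g-even v with v ≟ᶠ p
  ... | yes refl = cong parityℤ (updateAt-updates p f)
  ... | no v≢p   = trans (cong parityℤ (updateAt-minimal v p f v≢p)) (others v v≢p)

∂-+ : (s t : Fin m → Maybe (Fin n)) (x y : Fin m → ℤ) (w : Maybe (Fin n)) →
  ∂ s t (λ e → x e +ᶻ y e) w ≡ ∂ s t x w +ᶻ ∂ s t y w
∂-+ s t x y w = trans
  (sumℤ-cong λ e → ℤₚ.*-distribʳ-+ (δ (t e) w -ᶻ δ (s e) w) (x e) (y e))
  (sumℤ-+ (term s t x w) (term s t y w))

module _ (E : Fin m → Fin 2 → Maybe (Fin n)) (closed : ∀ e i → Σ[ v ∈ Fin n ] E e i ≡ just v) where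

  -- Over all vertices, an edge is counted once at its target and once with the opposite sign at its
  -- source.
  ∂-total : (x : Fin m → ℤ) → sumℤ (λ v → ∂ (source E) (target E) x (just v)) ≡ 0ℤ
  ∂-total x = trans (sumℤ-swap λ v e → term (source E) (target E) x (just v) e) (sumℤ-zero balanced)
    where
    balanced : ∀ e → sumℤ (λ v → term (source E) (target E) x (just v) e) ≡ 0ℤ
    balanced e with a , p ← closed e zero | b , q ← closed e (suc zero) rewrite p | q =
      trans (sumℤ-* (x e) (λ v → δ (just b) (just v) -ᶻ δ (just a) (just v)))
        (trans (cong (x e *ᶻ_) (sumℤ-δ-minus a b)) (ℤₚ.*-zeroʳ (x e)))

  ∂-nothing : (x : Fin m → ℤ) → ∂ (source E) (target E) x nothing ≡ 0ℤ
  ∂-nothing x = sumℤ-zero free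
    where
    free : ∀ e → term (source E) (target E) x nothing e ≡ 0ℤ
    free e with a , p ← closed e zero | b , q ← closed e (suc zero) rewrite p | q = ℤₚ.*-zeroʳ (x e)

  -- The reduction mod 2 of `∂-total` for the chain that is 1 on every edge.
  handshake : parity (sumℕ λ v → weight E (just v) (const 1)) ≡ 0ℙ
  handshake = trans (parity-sum _ (λ v → ∂ (source E) (target E) (const 1ℤ) (just v))
      λ v → parity-weight E (just v) (const 1) (const 1ℤ) λ _ → refl)
    (cong parityℤ (∂-total (const 1ℤ)))

-- Nowhere-zero 4-flows and nowhere-zero ℤ₂ × ℤ₂-flows

-- Values are colours, hence nonzero elements of ℤ₂ × ℤ₂: being nowhere zero is built into the type.
KleinFlow : Graph → Set
KleinFlow G = Σ[ c ∈ (Fin (nE G) → Fin 3) ] (∀ v → KleinAt (end G) c (just v))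

half : ∀ k → parity k ≡ 0ℙ → Σ[ h ∈ ℕ ] k ≡ h + h
half zero          _ = 0 , refl
half (suc (suc k)) p with h , eq ← half k p = suc h , cong suc (trans (cong suc eq) (sym (ℕₚ.+-suc h h)))

halfℤ : ∀ z → parityℤ z ≡ 0ℙ → Σ[ g ∈ ℤ ] z ≡ g +ᶻ g
halfℤ (nonneg k) p with h , eq ← half k p = nonneg h , cong nonneg eq
halfℤ -[1+ k ]   p with h , eq ← half (suc k) p =
  -ᶻ nonneg h , trans (cong (λ i → -ᶻ nonneg i) eq) (ℤₚ.neg-distrib-+ (nonneg h) (nonneg h))

double≡0 : ∀ z → z +ᶻ z ≡ 0ℤ → z ≡ 0ℤ
double≡0 (nonneg zero) _ = refl

∣double∣ : ∀ z → ∣ z +ᶻ z ∣ ≡ ∣ z ∣ + ∣ z ∣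
∣double∣ (nonneg k) = refl
∣double∣ -[1+ k ]   = cong suc (sym (ℕₚ.+-suc k k))

half-of-2 : ∀ k → k + k ≡ 2 → parity k ≡ 1ℙ
half-of-2 1 _ = refl
half-of-2 (suc (suc k)) eq = contradiction
  (ℕₚ.suc-injective (ℕₚ.suc-injective eq)) (ℕₚ.m+1+n≢0 k)

∣∣≤1 : ∀ z → ∣ z ∣ ≤ 1 → z ≡ 0ℤ ⊎ z ≡ 1ℤ ⊎ z ≡ -1ℤ
∣∣≤1 (nonneg 0) _ = inj₁ refl
∣∣≤1 (nonneg 1) _ = inj₂ (inj₁ refl)
∣∣≤1 (nonneg (suc (suc _))) (s≤s ())
∣∣≤1 -[1+ 0 ] _ = inj₂ (inj₂ refl)
∣∣≤1 -[1+ suc _ ] (s≤s ())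

-- If `x` is even, the bounds leave only ±2, while `y` is 0; then `g` is ±1 and odd. So the pair of
-- parities is never (0,0).
flow-value : ∀ x y g → 1 ≤ ∣ x ∣ → ∣ x ∣ ≤ 3 → ∣ y ∣ ≤ 1 → parityℤ y ≡ parityℤ x →
  x +ᶻ y ≡ g +ᶻ g → parityℤ x ≡ 1ℙ ⊎ parityℤ g ≡ 1ℙ
flow-value x y g lo hi small par eq with parityℤ x in px
... | 1ℙ = inj₁ refl
... | 0ℙ with ∣∣≤1 y small
...   | inj₂ (inj₁ refl) = contradiction par λ ()
...   | inj₂ (inj₂ refl) = contradiction par λ ()
...   | inj₁ refl = inj₂ (half-of-2 ∣ g ∣ (begin
  ∣ g ∣ + ∣ g ∣     ≡⟨ ∣double∣ g ⟨
  ∣ g +ᶻ g ∣        ≡⟨ cong ∣_∣ eq ⟨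
  ∣ x +ᶻ 0ℤ ∣       ≡⟨ cong ∣_∣ (ℤₚ.+-identityʳ x) ⟩
  ∣ x ∣             ≡⟨ two ∣ x ∣ lo hi px ⟩
  2                 ∎))
  where
  open ≡-Reasoning
  two : ∀ k → 1 ≤ k → k ≤ 3 → parity k ≡ 0ℙ → k ≡ 2
  two 2 _ _ _ = refl
  two (suc (suc (suc (suc _)))) _ (s≤s (s≤s (s≤s ()))) _

-- For `a`, `b` among 0 and ±1, the value a + 2b can vanish only if `a` is even, hence 0, and then
-- `b` is 0 as well.
combined-value : ∀ a b → ∣ a ∣ ≤ 1 → ∣ b ∣ ≤ 1 → parityℤ a ≡ 1ℙ ⊎ parityℤ b ≡ 1ℙ →
  1 ≤ ∣ a +ᶻ (b +ᶻ b) ∣ × ∣ a +ᶻ (b +ᶻ b) ∣ ≤ 3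
combined-value a b sa sb odd with ∣∣≤1 a sa | ∣∣≤1 b sb
... | inj₁ refl        | inj₁ refl        with odd
...   | inj₁ ()
...   | inj₂ ()
combined-value a b sa sb odd | inj₁ refl        | inj₂ (inj₁ refl) = s≤s z≤n , s≤s (s≤s z≤n)
combined-value a b sa sb odd | inj₁ refl        | inj₂ (inj₂ refl) = s≤s z≤n , s≤s (s≤s z≤n)
combined-value a b sa sb odd | inj₂ (inj₁ refl) | inj₁ refl        = s≤s z≤n , s≤s z≤n
combined-value a b sa sb odd | inj₂ (inj₁ refl) | inj₂ (inj₁ refl) = s≤s z≤n , s≤s (s≤s (s≤s z≤n))
combined-value a b sa sb odd | inj₂ (inj₁ refl) | inj₂ (inj₂ refl) = s≤s z≤n , s≤s z≤n
combined-value a b sa sb odd | inj₂ (inj₂ refl) | inj₁ refl        = s≤s z≤n , s≤s z≤n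
combined-value a b sa sb odd | inj₂ (inj₂ refl) | inj₂ (inj₁ refl) = s≤s z≤n , s≤s z≤n
combined-value a b sa sb odd | inj₂ (inj₂ refl) | inj₂ (inj₂ refl) = s≤s z≤n , s≤s (s≤s (s≤s z≤n))

if-* : (b : Bool) (k : ℤ) → (if b then k else 0ℤ) ≡ k *ᶻ (if b then 1ℤ else 0ℤ)
if-* true  k = sym (ℤₚ.*-identityʳ k)
if-* false k = sym (ℤₚ.*-zeroʳ k)

module _ (G : Graph) (closed : IsGraph G) where

  private
    s = source (end G)
    t = target (end G)

  -- Reversing an edge amounts to negating its value, so the orientation is absorbed into the signs.
  signed : (Fin (nE G) → Bool) → (Fin (nE G) → ℤ) → Fin (nE G) → ℤ
  signed o f e = if o e then -ᶻ f e else f e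

  kirchhoff-term : ∀ o f w e →
    (if ⌊ headE G o e ≟ᵐ w ⌋ then f e else 0ℤ) -ᶻ (if ⌊ tailE G o e ≟ᵐ w ⌋ then f e else 0ℤ)
      ≡ term s t (signed o f) w e
  kirchhoff-term o f w e with o e
  ... | true  = trans (cong₂ _-ᶻ_ (if-* ⌊ s e ≟ᵐ w ⌋ (f e)) (if-* ⌊ t e ≟ᵐ w ⌋ (f e)))
                  (reverse (f e) (δ (s e) w) (δ (t e) w))
    where
    reverse : ∀ k a b → k *ᶻ a -ᶻ k *ᶻ b ≡ (-ᶻ k) *ᶻ (b -ᶻ a)
    reverse = solve-∀
  ... | false = trans (cong₂ _-ᶻ_ (if-* ⌊ t e ≟ᵐ w ⌋ (f e)) (if-* ⌊ s e ≟ᵐ w ⌋ (f e)))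
                  (factor (f e) (δ (t e) w) (δ (s e) w))
    where
    factor : ∀ k a b → k *ᶻ a -ᶻ k *ᶻ b ≡ k *ᶻ (a -ᶻ b)
    factor = solve-∀

  ∣signed∣ : ∀ o f e → ∣ signed o f e ∣ ≡ ∣ f e ∣
  ∣signed∣ o f e with o e
  ... | true  = ℤₚ.∣-i∣≡∣i∣ (f e)
  ... | false = refl

  -- `even-boundary⇒cycle` also asks about the extra vertex `nothing`, which no edge of a closed
  -- graph meets.
  even-everywhere : (x : Fin (nE G) → ℤ) → (∀ v → parityℤ (∂ s t x (just v)) ≡ 0ℙ) →
    ∀ w → parityℤ (∂ s t x w) ≡ 0ℙ
  even-everywhere x ev (just v) = ev v
  even-everywhere x ev nothing  = cong parityℤ (∂-nothing (end G) closed x)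

  flow⇒klein : HasNZ4Flow G → KleinFlow G
  flow⇒klein (o , f , bounds , kirchhoff) = c , λ v →
      trans (parity-weight (end G) (just v) (bit₁ ∘ c) x (proj₁ ∘ bits)) (cong parityℤ (x-cycle v)) ,
      trans (parity-weight (end G) (just v) (bit₂ ∘ c) g (proj₂ ∘ bits)) (cong parityℤ (g-cycle v))
    where
    x : Fin (nE G) → ℤ
    x = signed o f
    x-cycle : ∀ v → ∂ s t x (just v) ≡ 0ℤ
    x-cycle v = trans (sumℤ-cong λ e → sym (kirchhoff-term o f (just v) e)) (kirchhoff v)
    lift : EvenLift s t x
    lift = even-boundary⇒cycle s t x (even-everywhere x (cong parityℤ ∘ x-cycle))
    y : Fin (nE G) → ℤ
    y = proj₁ lift
    y-parity : ∀ e → parityℤ (y e) ≡ parityℤ (x e)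
    y-parity = proj₁ (proj₂ (proj₂ lift))
    halves : ∀ e → Σ[ g ∈ ℤ ] x e +ᶻ y e ≡ g +ᶻ g
    halves e = halfℤ (x e +ᶻ y e) (trans (parityℤ-+ (x e) (y e))
      (trans (cong (parityℤ (x e) +ᵖ_) (y-parity e)) (ℙₚ.p+p≡0ℙ (parityℤ (x e)))))
    g : Fin (nE G) → ℤ
    g = proj₁ ∘ halves
    g-cycle : ∀ v → ∂ s t g (just v) ≡ 0ℤ
    -- Twice `g` is `x + y`, a sum of two cycles, and ℤ has no 2-torsion.
    g-cycle v = double≡0 (∂ s t g (just v)) (begin
      ∂ s t g (just v) +ᶻ ∂ s t g (just v)   ≡⟨ ∂-+ s t g g (just v) ⟨
      ∂ s t (λ e → g e +ᶻ g e) (just v)      ≡⟨ sumℤ-cong (λ e → cong (_*ᶻ (δ (t e) (just v) -ᶻ δ (s e) (just v))) (proj₂ (halves e))) ⟨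
      ∂ s t (λ e → x e +ᶻ y e) (just v)      ≡⟨ ∂-+ s t x y (just v) ⟩
      ∂ s t x (just v) +ᶻ ∂ s t y (just v)   ≡⟨ cong₂ _+ᶻ_ (x-cycle v) (proj₂ (proj₂ (proj₂ lift)) (just v)) ⟩
      0ℤ                                     ∎)
      where open ≡-Reasoning
    c : Fin (nE G) → Fin 3
    c e = colour (parityℤ (x e)) (parityℤ (g e))
    bits : ∀ e → parity (bit₁ (c e)) ≡ parityℤ (x e) × parity (bit₂ (c e)) ≡ parityℤ (g e)
    bits e = colour-bits (parityℤ (x e)) (parityℤ (g e)) (flow-value (x e) (y e) (g e)
      (subst (1 ≤_) (sym (∣signed∣ o f e)) (proj₁ (bounds e)))
      (subst (_≤ 3) (sym (∣signed∣ o f e)) (proj₂ (bounds e)))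
      (proj₁ (proj₂ lift) e) (y-parity e) (proj₂ (halves e)))

  bit-cycle : ∀ c (bit : Fin 3 → ℕ) → (∀ v → parity (weight (end G) (just v) (bit ∘ c)) ≡ 0ℙ) →
    EvenLift s t (nonneg ∘ bit ∘ c)
  bit-cycle c bit ev = even-boundary⇒cycle s t (nonneg ∘ bit ∘ c) (even-everywhere (nonneg ∘ bit ∘ c) λ v →
    trans (sym (parity-weight (end G) (just v) (bit ∘ c) (nonneg ∘ bit ∘ c) λ _ → refl)) (ev v))

  klein⇒flow : KleinFlow G → HasNZ4Flow G
  klein⇒flow (c , klein)
    with a , a-small , a-parity , a-cycle ← bit-cycle c bit₁ (proj₁ ∘ klein)
    with b , b-small , b-parity , b-cycle ← bit-cycle c bit₂ (proj₂ ∘ klein)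
    -- Every edge keeps its given direction; the signs of the values do the orienting.
    = const false , (λ e → a e +ᶻ (b e +ᶻ b e)) ,
      (λ e → combined-value (a e) (b e) (a-small e) (b-small e) (odd e (a-parity e) (b-parity e))) ,
      λ v → trans (sumℤ-cong λ e → kirchhoff-term (const false) (λ e → a e +ᶻ (b e +ᶻ b e)) (just v) e)
        (trans (∂-+ s t a (λ e → b e +ᶻ b e) (just v))
        (cong₂ _+ᶻ_ (a-cycle (just v)) (trans (∂-+ s t b b (just v)) (cong₂ _+ᶻ_ (b-cycle (just v)) (b-cycle (just v))))))
    where
    odd : ∀ e {p q} → p ≡ parity (bit₁ (c e)) → q ≡ parity (bit₂ (c e)) → p ≡ 1ℙ ⊎ q ≡ 1ℙ
    odd e p q with bits-odd (c e)
    ... | inj₁ o = inj₁ (trans p o)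
    ... | inj₂ o = inj₂ (trans q o)

-- Deleting and identifying vertices

delEnd⇒ : (u : Fin (suc n)) (x : Maybe (Fin (suc n))) {w : Fin n} →
  delEnd u x ≡ just w → x ≡ just (punchIn u w)
delEnd⇒ u (just x) eq with x ≟ᶠ u
... | no x≢u = cong just (trans (sym (punchIn-punchOut λ u≡x → x≢u (sym u≡x)))
                 (cong (punchIn u) (just-injective eq)))

delEnd⇐ : (u : Fin (suc n)) (w : Fin n) → delEnd u (just (punchIn u w)) ≡ just w
delEnd⇐ u w with punchIn u w ≟ᶠ u
... | yes eq = contradiction eq (punchInᵢ≢i u w)
... | no _   = cong just (trans (punchOut-cong u refl) (punchOut-punchIn u))

-- Two distinct vertices need at least two to choose from, and in this shape `remove2` computes:
-- `del` is its effect on ends, and `emb` lists the surviving vertices.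
module Remove2 {k : ℕ} (u v : Fin (suc (suc k))) (u≢v : u ≢ v) where

  del : Maybe (Fin (suc (suc k))) → Maybe (Fin k)
  del x = delEnd (punchOut u≢v) (delEnd u x)

  emb : Fin k → Fin (suc (suc k))
  emb w = punchIn u (punchIn (punchOut u≢v) w)

  del⇒ : ∀ x {w} → del x ≡ just w → x ≡ just (emb w)
  del⇒ x eq = delEnd⇒ u x (delEnd⇒ (punchOut u≢v) (delEnd u x) eq)

  del-emb : ∀ w → del (just (emb w)) ≡ just w
  del-emb w = trans (cong (delEnd (punchOut u≢v)) (delEnd⇐ u (punchIn (punchOut u≢v) w)))
    (delEnd⇐ (punchOut u≢v) w)

  emb≢u : ∀ w → emb w ≢ u
  emb≢u w = punchInᵢ≢i u (punchIn (punchOut u≢v) w)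

  emb≢v : ∀ w → emb w ≢ v
  emb≢v w eq = punchInᵢ≢i (punchOut u≢v) w (punchIn-injective u (punchIn (punchOut u≢v) w) (punchOut u≢v)
    (trans eq (sym (punchIn-punchOut u≢v))))

  emb-onto : ∀ w → w ≢ u → w ≢ v → Σ[ w′ ∈ Fin k ] emb w′ ≡ w
  emb-onto w w≢u w≢v = punchOut pv≢pw ,
    trans (cong (punchIn u) (punchIn-punchOut pv≢pw)) (punchIn-punchOut u≢w)
    where
    u≢w : u ≢ w
    u≢w eq = w≢u (sym eq)
    pv≢pw : punchOut u≢v ≢ punchOut u≢w
    pv≢pw eq = w≢v (sym (punchOut-injective u≢v u≢w eq))

-- Common ground between `remove2` and `identify`: phrased with the vertices of G, it is free of
-- either renumbering.
ColourableOff : (G : Graph) (u v : Fin (nV G)) → Set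
ColourableOff G u v = Σ[ c ∈ (Fin (nE G) → Fin 3) ]
  (∀ w → w ≢ u → w ≢ v → ProperAt (end G) c (just w))

remove2⇒off : ∀ G u v (u≢v : u ≢ v) → Colourable (remove2 G u v u≢v) → ColourableOff G u v
remove2⇒off (mkGraph (suc zero) m E) zero zero u≢v = contradiction refl u≢v
remove2⇒off (mkGraph (suc (suc k)) m E) u v u≢v (c , proper) = c , proper′
  where
  open Remove2 u v u≢v
  proper′ : ∀ w → w ≢ u → w ≢ v → ProperAt E c (just w)
  proper′ w w≢u w≢v e i e′ i′ ne p q with w′ , refl ← emb-onto w w≢u w≢v =
    proper w′ e i e′ i′ ne (trans (cong del p) (del-emb w′)) (trans (cong del q) (del-emb w′))

off⇒remove2 : ∀ G u v (u≢v : u ≢ v) → ColourableOff G u v → Colourable (remove2 G u v u≢v)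
off⇒remove2 (mkGraph (suc zero) m E) zero zero u≢v = contradiction refl u≢v
off⇒remove2 (mkGraph (suc (suc k)) m E) u v u≢v (c , proper) = c , λ w e i e′ i′ ne p q →
    proper (emb w) (emb≢u w) (emb≢v w) e i e′ i′ ne (del⇒ (E e i) p) (del⇒ (E e′ i′) q)
  where open Remove2 u v u≢v

module _ {k : ℕ} (u v : Fin (suc k)) (u≢v : u ≢ v) where

  merge-≢v : ∀ w (v≢w : v ≢ w) → mergeV u v u≢v w ≡ punchOut v≢w
  merge-≢v w v≢w with w ≟ᶠ v
  ... | yes eq = contradiction (sym eq) v≢w
  ... | no _   = punchOut-cong v refl

  -- Only `u` and `v` share an image, so it suffices that one of the two vertices avoids both.
  merge-injective : ∀ x w → w ≢ u → w ≢ v → mergeV u v u≢v x ≡ mergeV u v u≢v w → x ≡ w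
  merge-injective x w w≢u w≢v eq with x ≟ᶠ v
  ... | yes _  = contradiction (sym (punchOut-injective _ v≢w (trans eq (merge-≢v w v≢w)))) w≢u
    where v≢w = λ v≡w → w≢v (sym v≡w)
  ... | no x≢v = punchOut-injective _ v≢w (trans eq (merge-≢v w v≢w))
    where v≢w = λ v≡w → w≢v (sym v≡w)

  -- `punchIn v` is a section of the merging map; it avoids `v` and meets `u` only above the merged
  -- vertex.
  merge-onto : ∀ w′ → w′ ≢ mergeV u v u≢v u →
    Σ[ w ∈ Fin (suc k) ] w ≢ u × w ≢ v × mergeV u v u≢v w ≡ w′
  merge-onto w′ w′≢p = punchIn v w′ , (λ eq → w′≢p (trans (sym merged) (cong (mergeV u v u≢v) eq))) ,
      punchInᵢ≢i v w′ , merged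
    where
    merged : mergeV u v u≢v (punchIn v w′) ≡ w′
    merged = trans (merge-≢v (punchIn v w′) (λ eq → punchInᵢ≢i v w′ (sym eq))) (punchOut-punchIn v)

  map-merge⇒ : ∀ x w → w ≢ u → w ≢ v → map (mergeV u v u≢v) x ≡ just (mergeV u v u≢v w) → x ≡ just w
  map-merge⇒ (just x) w w≢u w≢v eq = cong just (merge-injective x w w≢u w≢v (just-injective eq))

  merge-weight : (E : Fin m → Fin 2 → Maybe (Fin (suc k))) (g : Fin m → ℕ) → ∀ w → w ≢ u → w ≢ v →
    weight E (just w) g ≡ weight (λ e i → map (mergeV u v u≢v) (E e i)) (just (mergeV u v u≢v w)) g
  merge-weight E g w w≢u w≢v = weight-transport E (λ e i → map (mergeV u v u≢v) (E e i)) g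
    (λ e i p → cong (map (mergeV u v u≢v)) p) (λ e i → map-merge⇒ (E e i) w w≢u w≢v)

identify-closed : ∀ G u v (u≢v : u ≢ v) → IsGraph G → IsGraph (identify G u v u≢v)
identify-closed (mkGraph (suc k) m E) u v u≢v closed e i with w , eq ← closed e i =
  mergeV u v u≢v w , cong (map (mergeV u v u≢v)) eq

off⇒klein : ∀ G → Cubic G → ∀ u v (u≢v : u ≢ v) → ColourableOff G u v → KleinFlow (identify G u v u≢v)
off⇒klein G@(mkGraph (suc k) m E) (closed , deg3) u v u≢v (c , proper) = c , klein
  where
  E′ : Fin m → Fin 2 → Maybe (Fin k)
  E′ e i = map (mergeV u v u≢v) (E e i)
  merged : Fin k
  merged = mergeV u v u≢v u
  elsewhere : ∀ w′ → w′ ≢ merged → KleinAt E′ c (just w′)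
  elsewhere w′ w′≢p with w , w≢u , w≢v , refl ← merge-onto u v u≢v w′ w′≢p
    with p , q ← proper⇒klein E c (just w) (deg3 w) (proper w w≢u w≢v)
    = trans (cong parity (sym (merge-weight u v u≢v E (bit₁ ∘ c) w w≢u w≢v))) p ,
      trans (cong parity (sym (merge-weight u v u≢v E (bit₂ ∘ c) w w≢u w≢v))) q
  at-merged : (bit : Fin 3 → ℕ) →
    (∀ w′ → w′ ≢ merged → parity (weight E′ (just w′) (bit ∘ c)) ≡ 0ℙ) →
    parity (weight E′ (just merged) (bit ∘ c)) ≡ 0ℙ
  at-merged bit others = trans (as-∂ merged)
    (even-elsewhere (λ w′ → ∂ (source E′) (target E′) x (just w′)) merged
      (cong parityℤ (∂-total E′ (identify-closed G u v u≢v closed) x))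
      λ w′ w′≢p → trans (sym (as-∂ w′)) (others w′ w′≢p))
    where
    x : Fin m → ℤ
    x e = nonneg (bit (c e))
    as-∂ : ∀ w′ → parity (weight E′ (just w′) (bit ∘ c)) ≡ parityℤ (∂ (source E′) (target E′) x (just w′))
    as-∂ w′ = parity-weight E′ (just w′) (bit ∘ c) x λ _ → refl
  klein : ∀ w′ → KleinAt E′ c (just w′)
  klein w′ with w′ ≟ᶠ merged
  ... | no w′≢p  = elsewhere w′ w′≢p
  ... | yes refl = at-merged bit₁ (λ w′ → proj₁ ∘ elsewhere w′) , at-merged bit₂ (λ w′ → proj₂ ∘ elsewhere w′)

klein⇒off : ∀ G → Cubic G → ∀ u v (u≢v : u ≢ v) → KleinFlow (identify G u v u≢v) → ColourableOff G u v
klein⇒off (mkGraph (suc k) m E) (closed , deg3) u v u≢v (c , klein) = c , λ w w≢u w≢v →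
  klein⇒proper E c (just w) (deg3 w)
    (trans (cong parity (merge-weight u v u≢v E (bit₁ ∘ c) w w≢u w≢v)) (proj₁ (klein (mergeV u v u≢v w))) ,
     trans (cong parity (merge-weight u v u≢v E (bit₂ ∘ c) w w≢u w≢v)) (proj₂ (klein (mergeV u v u≢v w))))

-- Bicritical and 4-vertex-critical cubic graphs

bicritical⇒critical : ∀ G → Cubic G → Bicritical G → FourVertexCritical G
bicritical⇒critical G cubic@(closed , _) bicritical u v u≢v =
  klein⇒flow (identify G u v u≢v) (identify-closed G u v u≢v closed)
    (off⇒klein G cubic u v u≢v (remove2⇒off G u v u≢v (bicritical u v u≢v)))

critical⇒bicritical : ∀ G → Cubic G → FourVertexCritical G → Bicritical G
critical⇒bicritical G cubic@(closed , _) critical u v u≢v = off⇒remove2 G u v u≢v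
  (klein⇒off G cubic u v u≢v (flow⇒klein (identify G u v u≢v) (identify-closed G u v u≢v closed) (critical u v u≢v)))

-- Bicritical snarks are irreducible

parity-triple : ∀ n → parity (sumℕ {n} (const 3)) ≡ parity n
parity-triple zero    = refl
parity-triple (suc n) = trans (ℙₚ.+-homo-+ 3 (sumℕ {n} (const 3)))
  (trans (cong (1ℙ +ᵖ_) (parity-triple n)) (sym (ℙₚ.+-homo-+ 1 n)))

-- By the handshake lemma the degree sum, three times the number of vertices, is even.
cubic⇒even : ∀ G → Cubic G → parity (nV G) ≡ 0ℙ
cubic⇒even G (closed , deg3) = trans (sym (parity-triple (nV G)))
  (trans (cong parity (sumℕ-cong (sym ∘ deg3))) (handshake (end G) closed))

even-gap : ∀ {a b} → parity a ≡ 0ℙ → parity b ≡ 0ℙ → a < b → suc a < b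
even-gap {a} pa pb a<b = ℕₚ.≤∧≢⇒< a<b λ { refl →
  contradiction (trans (sym pb) (trans (ℙₚ.+-homo-+ 1 a) (cong (1ℙ +ᵖ_) pa))) λ () }

-- Pigeonhole: if `S` were everything, `φ` would inject the vertices into a smaller set.
outside : ∀ {k} (S : Fin n → Bool) (φ : Fin n → Fin k) →
  (∀ u v → S u ≡ true → S v ≡ true → φ u ≡ φ v → u ≡ v) → k < n → Σ[ u ∈ Fin n ] S u ≡ false
outside {n} S φ inj k<n
  with u , ¬Su ← ¬∀⟶∃¬ n (λ u → S u ≡ true) (λ u → S u ≟ᵇ true)
         (λ all → ℕₚ.<⇒≱ k<n (injective⇒≤ {f = φ} λ {u} {v} → inj u v (all u) (all v)))
  = u , ¬true⇒false (S u) ¬Su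
  where
  ¬true⇒false : ∀ b → b ≢ true → b ≡ false
  ¬true⇒false false _ = refl
  ¬true⇒false true  ne = contradiction refl ne

-- After the first vertex is dropped, `φ` is still injective on the rest of `S`, and the bound
-- leaves room for a second use of the pigeonhole.
two-outside : ∀ {k} (S : Fin n → Bool) (φ : Fin n → Fin k) →
  (∀ u v → S u ≡ true → S v ≡ true → φ u ≡ φ v → u ≡ v) → suc k < n →
  Σ[ u ∈ Fin n ] Σ[ v ∈ Fin n ] u ≢ v × S u ≡ false × S v ≡ false
two-outside {suc n} S φ inj (s≤s k<n)
  with u , Su ← outside S φ inj (ℕₚ.m≤n⇒m≤1+n k<n)
  with v , Sv ← outside (S ∘ punchIn u) (φ ∘ punchIn u)
         (λ x y Sx Sy eq → punchIn-injective u x y (inj (punchIn u x) (punchIn u y) Sx Sy eq)) k<n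
  = u , punchIn u v , punchInᵢ≢i u v ∘ sym , Su , Sv

bicritical⇒kIrreducible : ∀ G → Cubic G → Bicritical G → ∀ k → KIrreducible k G
bicritical⇒kIrreducible G cubic bicritical k F _ S _ uncolourable (H , H-cubic , H<G , φ , _ , φ-inj , _)
  with u , v , u≢v , Su , Sv ← two-outside S φ φ-inj (even-gap (cubic⇒even H H-cubic) (cubic⇒even G cubic) H<G)
  with c , proper ← remove2⇒off G u v u≢v (bicritical u v u≢v)
  -- Both halves of a removed edge inherit the colour of that edge.
  = uncolourable ((λ e _ → c e) , (λ _ _ → refl) , λ w Sw →
      proper w (λ { refl → contradiction (trans (sym Sw) Su) λ () })
               (λ { refl → contradiction (trans (sym Sw) Sv) λ () }))

-- Connected components

Linked : (Fin m → Maybe (Fin n × Fin n)) → Fin n → Fin n → Set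
Linked {m} L u v = Σ[ e ∈ Fin m ] (L e ≡ just (u , v) ⊎ L e ≡ just (v , u))

-- Equal labels mean the same connected component. Membership thereby becomes decidable, as the
-- Boolean vertex set in `Component` requires.
Labelling : (Fin m → Maybe (Fin n × Fin n)) → Set
Labelling {m} {n} L = Σ[ r ∈ (Fin n → Fin n) ]
  (∀ e {u v} → L e ≡ just (u , v) → r u ≡ r v) × (∀ u v → r u ≡ r v → Star (Linked L) u v)

-- Union–find: adding a link a–b relabels the class of b by the label of a.
labelling : (L : Fin m → Maybe (Fin n × Fin n)) → Labelling L
labelling {zero}  L = (λ x → x) , (λ ()) , λ { u .u refl → stay }
labelling {suc m} {n} L with labelling (L ∘ suc) | L zero in eq₀
... | r , sound , complete | nothing = r , sound′ , λ u v eq → gmap (λ x → x) later (complete u v eq)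
  where
  sound′ : ∀ e {u v} → L e ≡ just (u , v) → r u ≡ r v
  sound′ zero    eq = contradiction (trans (sym eq₀) eq) λ ()
  sound′ (suc e) eq = sound e eq
  later : ∀ {u v} → Linked (L ∘ suc) u v → Linked L u v
  later (e , l) = suc e , l
... | r , sound , complete | just (a , b) = relabel ∘ r , sound′ , complete′
  where
  relabel : Fin n → Fin n
  relabel x with x ≟ᶠ r b
  ... | yes _ = r a
  ... | no _  = x
  relabel-a : relabel (r a) ≡ r a
  relabel-a with r a ≟ᶠ r b
  ... | yes _ = refl
  ... | no _  = refl
  relabel-b : relabel (r b) ≡ r a
  relabel-b with r b ≟ᶠ r b
  ... | yes _  = refl
  ... | no b≢b = contradiction refl b≢b
  sound′ : ∀ e {u v} → L e ≡ just (u , v) → relabel (r u) ≡ relabel (r v)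
  sound′ zero    eq with refl ← trans (sym eq₀) eq = trans relabel-a (sym relabel-b)
  sound′ (suc e) eq = cong relabel (sound e eq)
  later : ∀ {u v} → r u ≡ r v → Star (Linked L) u v
  later {u} {v} eq = gmap (λ x → x) (λ (e , l) → suc e , l) (complete u v eq)
  complete′ : ∀ u v → relabel (r u) ≡ relabel (r v) → Star (Linked L) u v
  complete′ u v eq with r u ≟ᶠ r b | r v ≟ᶠ r b
  ... | yes p | yes q = later (trans p (sym q))
  -- Only one of the two vertices had the label of `b`, so the other has that of `a`, and the path
  -- crosses the new link.
  ... | yes p | no _  = later p ◅◅ ((zero , inj₂ eq₀) ◅ later eq)
  ... | no _  | yes q = later eq ◅◅ ((zero , inj₁ eq₀) ◅ later (sym q))
  ... | no _  | no _  = later eq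

-- Decidability of colourability

-- Exhaustive search over the first value and then the others. Functions are rebuilt only up to
-- pointwise equality, which `P` must therefore respect.
search : ∀ {k} m (P : (Fin m → Fin k) → Set) → (∀ {f g} → (∀ i → f i ≡ g i) → P f → P g) →
  (∀ f → Dec (P f)) → Dec (∃ P)
search zero P resp P? with P? (λ ())
... | yes p = yes (_ , p)
... | no ¬p = no λ (f , p) → ¬p (resp (λ ()) p)
search (suc m) P resp P?
  with any? (λ x → search m (λ f → P (x ∷ f))
              (λ eq → resp λ { zero → refl ; (suc i) → eq i }) (λ f → P? (x ∷ f)))
... | yes (x , f , p) = yes (x ∷ f , p)
... | no none = no λ (f , p) → none (f zero , f ∘ suc , resp (λ { zero → refl ; (suc i) → refl }) p)

colourable? : ∀ G → Dec (Colourable G)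
colourable? G = search (nE G)
  (λ c → ∀ v e i e′ i′ → (e , i) ≢ (e′ , i′) → end G e i ≡ just v → end G e′ i′ ≡ just v → c e ≢ c e′)
  (λ eq proper v e i e′ i′ ne p q same → proper v e i e′ i′ ne p q (trans (eq e) (trans same (sym (eq e′)))))
  (λ c → all? λ v → all? λ e → all? λ i → all? λ e′ → all? λ i′ →
     ¬? (×-≡-dec _≟ᶠ_ _≟ᶠ_ (e , i) (e′ , i′)) →-dec ((end G e i ≟ᵐ just v) →-dec
       ((end G e′ i′ ≟ᵐ just v) →-dec ¬? (c e ≟ᶠ c e′))))

-- For the components of G - {u, v}: irreducibility only refutes that one is uncolourable, and these
-- finitely many double negations have to be taken together.
¬¬-all : {P : Fin n → Set} → (∀ i → ¬ ¬ P i) → ¬ ¬ (∀ i → P i)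
¬¬-all {zero}  _ k = k λ ()
¬¬-all {suc n} h k = h zero λ p₀ → ¬¬-all (h ∘ suc) λ ps → k λ { zero → p₀ ; (suc i) → ps i }

-- Joining the dangling edges in pairs

Full : (Fin m → Fin 2 → Maybe (Fin n)) → Fin m → Set
Full {n = n} E e = ∀ i → Σ[ v ∈ Fin n ] E e i ≡ just v

-- The dangling edges are joined greedily; pending is the one still waiting for a partner.
record Pairing (E : Fin m → Fin 2 → Maybe (Fin n)) : Set where
  field
    size       : ℕ
    ends       : Fin size → Fin 2 → Fin n
    pending    : Maybe (Fin n)
    degree     : ∀ v → weight E (just v) (const 1) ≡
                   weight (λ e i → just (ends e i)) (just v) (const 1) + atEnd pending (just v) 1
    place      : Fin m → Maybe (Fin size)
    place-full : ∀ e → Full E e → Σ[ f ∈ Fin size ] place e ≡ just f × (∀ i → just (ends f i) ≡ E e i)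
    place-inj  : ∀ e e′ {f} → place e ≡ just f → place e′ ≡ just f → e ≡ e′

pair-ends : Fin n → Fin n → Fin 2 → Fin n
pair-ends a b zero    = a
pair-ends a b (suc _) = b

map-suc-just : (x : Maybe (Fin n)) {f : Fin (suc n)} → map suc x ≡ just f → Σ[ g ∈ Fin n ] f ≡ suc g × x ≡ just g
map-suc-just (just x) refl = x , refl , refl

module _ (E : Fin (suc m) → Fin 2 → Maybe (Fin n)) (P : Pairing (E ∘ suc)) where
  open Pairing P

  private
    headWeight : Fin n → ℕ
    headWeight v = edgeWeight E (just v) (const 1) zero

    shifted-inj : ∀ e e′ {f} → map suc (place e) ≡ just f → map suc (place e′) ≡ just f →
      _≡_ {A = Fin (suc m)} (suc e) (suc e′)
    shifted-inj e e′ eq eq′ with g , refl , p ← map-suc-just (place e) eq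
      with _ , refl , q ← map-suc-just (place e′) eq′ = cong suc (place-inj e e′ p q)

  keep-nothing : (∀ v → headWeight v ≡ 0) → ¬ Full E zero → Pairing E
  keep-nothing none ¬full = record
    { size       = size
    ; ends       = ends
    ; pending    = pending
    ; degree     = λ v → trans (cong (_+ weight (E ∘ suc) (just v) (const 1)) (none v)) (degree v)
    ; place      = λ { zero → nothing ; (suc e) → place e }
    ; place-full = λ { zero full → contradiction full ¬full ; (suc e) full → place-full e full }
    ; place-inj  = λ { (suc e) (suc e′) p q → cong suc (place-inj e e′ p q) }
    }

  keep-edge : ∀ a b → E zero zero ≡ just a → E zero (suc zero) ≡ just b → Pairing E
  keep-edge a b p q = record
    { size       = suc size
    ; ends       = pair-ends a b ∷ ends
    ; pending    = pending
    ; degree     = λ v → trans (cong₂ (λ x y → (atEnd x (just v) 1 + (atEnd y (just v) 1 + 0)) + weight (E ∘ suc) (just v) (const 1)) p q)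
                     (trans (cong ((atEnd (just a) (just v) 1 + (atEnd (just b) (just v) 1 + 0)) +_) (degree v))
                       (sym (ℕₚ.+-assoc (atEnd (just a) (just v) 1 + (atEnd (just b) (just v) 1 + 0)) _ _)))
    ; place      = λ { zero → just zero ; (suc e) → map suc (place e) }
    ; place-full = λ { zero _ → zero , refl , (λ { zero → sym p ; (suc zero) → sym q })
                     ; (suc e) full → let f , eq , same = place-full e full in suc f , cong (map suc) eq , same }
    ; place-inj  = λ { zero zero _ _ → refl
                     ; zero (suc e′) refl eq → contradiction (map-suc-just (place e′) eq) λ ()
                     ; (suc e) zero eq refl → contradiction (map-suc-just (place e) eq) λ ()
                     ; (suc e) (suc e′) eq eq′ → shifted-inj e e′ eq eq′ }
    }

  keep-dangling : ∀ a → (∀ v → headWeight v ≡ atEnd (just a) (just v) 1) → ¬ Full E zero → Pairing E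
  keep-dangling a one ¬full with pending in eq
  ... | nothing = record
    { size       = size
    ; ends       = ends
    ; pending    = just a
    ; degree     = λ v → trans (cong₂ _+_ (one v) (trans (degree v) (cong (λ x → weight (λ e i → just (ends e i)) (just v) (const 1) + atEnd x (just v) 1) eq)))
                     (rearrange (atEnd (just a) (just v) 1) (weight (λ e i → just (ends e i)) (just v) (const 1)))
    ; place      = λ { zero → nothing ; (suc e) → place e }
    ; place-full = λ { zero full → contradiction full ¬full ; (suc e) full → place-full e full }
    ; place-inj  = λ { (suc e) (suc e′) p q → cong suc (place-inj e e′ p q) }
    }
    where
    rearrange : ∀ x y → x + (y + 0) ≡ y + x
    rearrange = ℕ-Solver.solve-∀
  ... | just b = record
    { size       = suc size
    ; ends       = pair-ends a b ∷ ends
    ; pending    = nothing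
    ; degree     = λ v → trans (cong₂ _+_ (one v) (trans (degree v) (cong (λ x → weight (λ e i → just (ends e i)) (just v) (const 1) + atEnd x (just v) 1) eq)))
                     (rearrange (atEnd (just a) (just v) 1) (weight (λ e i → just (ends e i)) (just v) (const 1)) (atEnd (just b) (just v) 1))
    ; place      = λ { zero → nothing ; (suc e) → map suc (place e) }
    ; place-full = λ { zero full → contradiction full ¬full
                     ; (suc e) full → let f , eq , same = place-full e full in suc f , cong (map suc) eq , same }
    ; place-inj  = λ { (suc e) (suc e′) p q → shifted-inj e e′ p q }
    }
    where
    rearrange : ∀ x y z → x + (y + z) ≡ ((x + (z + 0)) + y) + 0
    rearrange = ℕ-Solver.solve-∀

pairing : (E : Fin m → Fin 2 → Maybe (Fin n)) → Pairing E
pairing {zero} E = record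
  { size = 0 ; ends = λ () ; pending = nothing ; degree = λ _ → refl
  ; place = λ () ; place-full = λ () ; place-inj = λ () }
pairing {suc m} E with E zero zero in p | E zero (suc zero) in q
... | just a  | just b  = keep-edge E (pairing (E ∘ suc)) a b p q
... | just a  | nothing = keep-dangling E (pairing (E ∘ suc)) a
    (λ v → trans (cong₂ (λ x y → atEnd x (just v) 1 + (atEnd y (just v) 1 + 0)) p q) (ℕₚ.+-identityʳ _))
    λ full → contradiction (trans (sym q) (proj₂ (full (suc zero)))) λ ()
... | nothing | just b  = keep-dangling E (pairing (E ∘ suc)) b
    (λ v → trans (cong₂ (λ x y → atEnd x (just v) 1 + (atEnd y (just v) 1 + 0)) p q) (ℕₚ.+-identityʳ _))
    λ full → contradiction (trans (sym p) (proj₂ (full zero))) λ ()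
... | nothing | nothing = keep-nothing E (pairing (E ∘ suc))
    (λ v → cong₂ (λ x y → atEnd x (just v) 1 + (atEnd y (just v) 1 + 0)) p q)
    λ full → contradiction (trans (sym p) (proj₂ (full zero))) λ ()

-- Completion to a cubic graph on the same vertices

module _ (E : Fin m → Fin 2 → Maybe (Fin n)) (deg3 : ∀ v → weight E (just v) (const 1) ≡ 3)
  (even : parity n ≡ 0ℙ) where
  open Pairing (pairing E)

  completion : Graph
  completion = mkGraph n size (λ e i → just (ends e i))

  completion-closed : IsGraph completion
  completion-closed e i = ends e i , refl

  -- A leftover end would make the degree sum of the completion 3n - 1, which is odd for even `n`,
  -- against the handshake lemma.
  none-pending : pending ≡ nothing
  none-pending with pending in eq
  ... | nothing = refl
  ... | just a = contradiction (begin
    1ℙ ≡⟨ cong parityℤ (sumℤ-δ a) ⟨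
    parityℤ (sumℤ (λ v → δ (just a) (just v)))
      ≡⟨ parity-sum (λ v → atEnd (just a) (just v) 1) (λ v → δ (just a) (just v)) (λ v → parity-atEnd (just a) (just v) 1) ⟨
    parity (sumℕ (λ v → atEnd (just a) (just v) 1))
      ≡⟨ cong (_+ᵖ parity (sumℕ (λ v → atEnd (just a) (just v) 1))) (handshake (end completion) completion-closed) ⟨
    parity (sumℕ (deg completion)) +ᵖ parity (sumℕ (λ v → atEnd (just a) (just v) 1))
      ≡⟨ ℙₚ.+-homo-+ (sumℕ (deg completion)) _ ⟨
    parity (sumℕ (deg completion) + sumℕ (λ v → atEnd (just a) (just v) 1))
      ≡⟨ cong parity (sumℕ-+ (deg completion) (λ v → atEnd (just a) (just v) 1)) ⟨
    parity (sumℕ (λ v → deg completion v + atEnd (just a) (just v) 1))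
      ≡⟨ cong parity (sumℕ-cong (λ v → trans (cong (λ x → deg completion v + atEnd x (just v) 1) (sym eq)) (trans (sym (degree v)) (deg3 v)))) ⟩
    parity (sumℕ {n} (const 3)) ≡⟨ parity-triple n ⟩
    parity n ≡⟨ even ⟩
    0ℙ ∎) λ ()
    where open ≡-Reasoning

  completion-cubic : Cubic completion
  completion-cubic = completion-closed , λ v → trans (sym (ℕₚ.+-identityʳ (deg completion v)))
    (trans (cong (λ x → deg completion v + atEnd x (just v) 1) (sym none-pending)) (trans (sym (degree v)) (deg3 v)))

-- Uncolourable components of G − {u, v}

⌊⌋-true : ∀ {A : Set} (a? : Dec A) → ⌊ a? ⌋ ≡ true → A
⌊⌋-true (yes a) _ = a

true-⌊⌋ : ∀ {A : Set} (a? : Dec A) → A → ⌊ a? ⌋ ≡ true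
true-⌊⌋ (yes _) _ = refl
true-⌊⌋ (no ¬a) a = contradiction a ¬a

⌊⌋-false : ∀ {A : Set} (a? : Dec A) → ⌊ a? ⌋ ≡ false → ¬ A
⌊⌋-false (no ¬a) _ = ¬a

false-⌊⌋ : ∀ {A : Set} (a? : Dec A) → ¬ A → ⌊ a? ⌋ ≡ false
false-⌊⌋ (no _)  _  = refl
false-⌊⌋ (yes a) ¬a = contradiction a ¬a

≢nothing : {x : Maybe (Fin n)} → x ≢ nothing → Σ[ v ∈ Fin n ] x ≡ just v
≢nothing {x = just v}  _  = v , refl
≢nothing {x = nothing} ne = contradiction refl ne

pairEnds : Maybe (Fin n) → Maybe (Fin n) → Maybe (Fin n × Fin n)
pairEnds (just a) (just b) = just (a , b)
pairEnds _        _        = nothing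

pairEnds-just : (x y : Maybe (Fin n)) {a b : Fin n} → pairEnds x y ≡ just (a , b) → x ≡ just a × y ≡ just b
pairEnds-just (just a) (just b) refl = refl , refl

module _ {k m : ℕ} (E : Fin m → Fin 2 → Maybe (Fin (suc (suc k)))) (cubic : Cubic (mkGraph (suc (suc k)) m E))
  (u v : Fin (suc (suc k))) (u≢v : u ≢ v) where

  open Remove2 u v u≢v

  private
    G : Graph
    G = mkGraph (suc (suc k)) m E

    rest : Fin m → Fin 2 → Maybe (Fin k)
    rest e i = del (E e i)

  rest-degree : ∀ w → weight rest (just w) (const 1) ≡ 3
  rest-degree w = trans (weight-transport rest E {w′ = just (emb w)} (const 1) (λ e i → del⇒ (E e i))
    (λ e i p → trans (cong del p) (del-emb w))) (proj₂ cubic (emb w))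

  H : Graph
  -- `parity` recurses in steps of two, so evenness of the order of G is already evenness of `k`.
  H = completion rest rest-degree (cubic⇒even G cubic)

  H-cubic : Cubic H
  H-cubic = completion-cubic rest rest-degree (cubic⇒even G cubic)

  touches? : ∀ e → Dec (Σ[ i ∈ Fin 2 ] rest e i ≡ nothing)
  touches? e = any? λ i → rest e i ≟ᵐ nothing

  -- The edges that meet `u` or `v`: G has no free ends, so an end missing in `rest` was deleted.
  F : Fin m → Bool
  F e = ⌊ touches? e ⌋

  F-false⇒full : ∀ e → F e ≡ false → Full rest e
  F-false⇒full e Fe i = ≢nothing λ eq → ⌊⌋-false (touches? e) Fe (i , eq)

  full⇒F-false : ∀ e → Full rest e → F e ≡ false
  full⇒F-false e full = false-⌊⌋ (touches? e) λ (i , eq) → contradiction (trans (sym eq) (proj₂ (full i))) λ ()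

  deleted : ∀ y → del (just y) ≡ nothing → y ≡ u ⊎ y ≡ v
  deleted y eq = split (y ≟ᶠ u) (y ≟ᶠ v)
    where
    split : Dec (y ≡ u) → Dec (y ≡ v) → y ≡ u ⊎ y ≡ v
    split (yes y≡u) _         = inj₁ y≡u
    split (no _)    (yes y≡v) = inj₂ y≡v
    split (no y≢u)  (no y≢v) with w , refl ← emb-onto y y≢u y≢v =
      contradiction (trans (sym eq) (del-emb w)) λ ()

  -- Each edge of `F` is counted in the degree of `u` or of `v`, and these add up to 6.
  F-small : count F < 7
  F-small = s≤s (begin
    count F
      ≤⟨ sumℕ-mono bound ⟩
    sumℕ (λ e → edgeWeight E (just u) (const 1) e + edgeWeight E (just v) (const 1) e)
      ≡⟨ sumℕ-+ (edgeWeight E (just u) (const 1)) (edgeWeight E (just v) (const 1)) ⟩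
    deg G u + deg G v
      ≡⟨ cong₂ _+_ (proj₂ cubic u) (proj₂ cubic v) ⟩
    6 ∎)
    where
    open ℕₚ.≤-Reasoning
    bound : ∀ e → (if F e then 1 else 0) ≤ edgeWeight E (just u) (const 1) e + edgeWeight E (just v) (const 1) e
    bound e with touches? e
    ... | no _ = z≤n
    ... | yes (i , free) with y , eq ← proj₁ cubic e i with deleted y (trans (cong del (sym eq)) free)
    ...   | inj₁ refl = ℕₚ.≤-trans (edgeWeight-pos E {g = const 1} e i eq (s≤s z≤n)) (ℕₚ.m≤m+n _ _)
    ...   | inj₂ refl = ℕₚ.≤-trans (edgeWeight-pos E {g = const 1} e i eq (s≤s z≤n)) (ℕₚ.m≤n+m _ (edgeWeight E (just u) (const 1) e))

  links : Fin m → Maybe (Fin k × Fin k)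
  links e = pairEnds (rest e zero) (rest e (suc zero))

  label : Fin k → Fin k
  label = proj₁ (labelling links)

  label-edge : ∀ e {a b} → rest e zero ≡ just a → rest e (suc zero) ≡ just b → label a ≡ label b
  label-edge e p q = proj₁ (proj₂ (labelling links)) e (cong₂ pairEnds p q)

  member? : ∀ ℓ y → Dec (map label (del (just y)) ≡ just ℓ)
  member? ℓ y = map label (del (just y)) ≟ᵐ just ℓ

  -- The class of one label, seen in G. As `del` sends `u` and `v` to `nothing`, they have no label
  -- and lie in no class.
  S : Fin k → Fin (suc (suc k)) → Bool
  S ℓ y = ⌊ member? ℓ y ⌋

  S⇒ : ∀ ℓ y → S ℓ y ≡ true → Σ[ w ∈ Fin k ] y ≡ emb w × label w ≡ ℓ
  S⇒ ℓ y Sy with del (just y) in eq | ⌊⌋-true (member? ℓ y) Sy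
  ... | just w | same = w , just-injective (del⇒ (just y) eq) , just-injective same

  S⇐ : ∀ ℓ w → label w ≡ ℓ → S ℓ (emb w) ≡ true
  S⇐ ℓ w eq = true-⌊⌋ (member? ℓ (emb w)) (trans (cong (map label) (del-emb w)) (cong just eq))

  S-component : ∀ w → Component G F (S (label w))
  S-component w = (emb w , S⇐ ℓ w refl) , closed , connected
    where
    ℓ = label w
    closed : ∀ e x y → F e ≡ false → E e zero ≡ just x → E e (suc zero) ≡ just y → S ℓ x ≡ S ℓ y
    closed e x y Fe p q with a , a-end ← F-false⇒full e Fe zero | b , b-end ← F-false⇒full e Fe (suc zero) =
      cong (λ z → ⌊ z ≟ᵐ just ℓ ⌋) (trans (cong (map label) (trans (cong del (sym p)) a-end))
        (trans (cong just (label-edge e a-end b-end)) (cong (map label) (trans (sym b-end) (cong del q)))))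
    off : ∀ {a b} → Linked links a b → AdjOff G F (S ℓ) (emb a) (emb b)
    off (e , inj₁ eq) with p , q ← pairEnds-just (rest e zero) (rest e (suc zero)) eq =
      e , full⇒F-false e (λ { zero → _ , p ; (suc zero) → _ , q }) , inj₁ (del⇒ (E e zero) p , del⇒ (E e (suc zero)) q)
    off (e , inj₂ eq) with p , q ← pairEnds-just (rest e zero) (rest e (suc zero)) eq =
      e , full⇒F-false e (λ { zero → _ , p ; (suc zero) → _ , q }) , inj₂ (del⇒ (E e zero) p , del⇒ (E e (suc zero)) q)
    connected : ∀ x y → S ℓ x ≡ true → S ℓ y ≡ true → Star (AdjOff G F (S ℓ)) x y
    connected x y Sx Sy with a , refl , p ← S⇒ ℓ x Sx with b , refl , q ← S⇒ ℓ y Sy =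
      gmap emb off (proj₂ (proj₂ (labelling links)) a b (trans p (sym q)))

  S-completable : ∀ w → CompletableToSmaller G F (S (label w))
  S-completable w = H , H-cubic , s≤s (ℕₚ.n≤1+n k) , φ , ψ , φ-inj , ψ-inj , λ e int → inj₁ (incidence e int)
    where
    open Pairing (pairing rest)
    ℓ = label w
    φ : Fin (suc (suc k)) → Fin k
    -- The default `w` is taken only at `u` and `v`, which are outside the component.
    φ y = fromMaybe w (del (just y))
    φ-emb : ∀ a → φ (emb a) ≡ a
    φ-emb a = cong (fromMaybe w) (del-emb a)
    -- A default for the edges without a place; it exists because `w` has degree 3 in `H`.
    some-edge : Fin size
    some-edge = proj₁ (sumℕ-pos (edgeWeight (end H) (just w) (const 1))
      (subst (0 <_) (sym (proj₂ H-cubic w)) (s≤s z≤n)))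
    ψ : Fin m → Fin size
    ψ e = fromMaybe some-edge (place e)
    φ-inj : ∀ x y → S ℓ x ≡ true → S ℓ y ≡ true → φ x ≡ φ y → x ≡ y
    φ-inj x y Sx Sy eq with a , refl , _ ← S⇒ ℓ x Sx with b , refl , _ ← S⇒ ℓ y Sy =
      cong emb (trans (sym (φ-emb a)) (trans eq (φ-emb b)))
    full : ∀ e → Internal G F (S ℓ) e → Full rest e
    full e (Fe , _) = F-false⇒full e Fe
    ψ-place : ∀ e (int : Internal G F (S ℓ) e) → place e ≡ just (ψ e) × (∀ i → just (ends (ψ e) i) ≡ rest e i)
    ψ-place e int with f , eq , same ← place-full e (full e int) rewrite eq = refl , same
    ψ-inj : ∀ e e′ → Internal G F (S ℓ) e → Internal G F (S ℓ) e′ → ψ e ≡ ψ e′ → e ≡ e′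
    ψ-inj e e′ int int′ eq = place-inj e e′ (proj₁ (ψ-place e int))
      (trans (proj₁ (ψ-place e′ int′)) (cong just (sym eq)))
    incidence : ∀ e → Internal G F (S ℓ) e → ∀ i → just (ends (ψ e) i) ≡ map φ (E e i)
    incidence e int i with a , eq ← full e int i = trans (proj₂ (ψ-place e int) i)
      (trans eq (trans (cong just (sym (φ-emb a))) (cong (map φ) (sym (del⇒ (E e i) eq)))))

  ColouredLabel : Fin k → Set
  ColouredLabel ℓ = Σ[ c ∈ (Fin m → Fin 2 → Fin 3) ]
    (∀ e → F e ≡ false → c e zero ≡ c e (suc zero)) ×
    (∀ w → label w ≡ ℓ → ∀ e i e′ i′ → (e , i) ≢ (e′ , i′) →
       rest e i ≡ just w → rest e′ i′ ≡ just w → c e i ≢ c e′ i′)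

  -- An uncolourable class would be a component cut off by fewer than seven edges and completable to
  -- `H`, against irreducibility.
  some-colouring : KIrreducible 7 G → ∀ ℓ → ¬ ¬ ColouredLabel ℓ
  some-colouring irreducible ℓ none with any? (λ w → label w ≟ᶠ ℓ)
  -- No vertex has this label, so a constant colouring is vacuously proper.
  ... | no empty = none ((λ _ _ → red) , (λ _ _ → refl) , λ w eq → contradiction (w , eq) empty)
  ... | yes (w , refl) = irreducible F F-small (S ℓ) (S-component w)
    (λ (c , consistent , proper) → none (c , consistent , λ w′ eq e i e′ i′ ne p q →
      proper (emb w′) (S⇐ ℓ w′ eq) e i e′ i′ ne (del⇒ (E e i) p) (del⇒ (E e′ i′) q)))
    (S-completable w)

  -- An edge takes its colour from the component of a surviving end. If both ends survive, they have
  -- the same label, and the colouring of that component agrees on the two ends.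
  assemble : (∀ ℓ → ColouredLabel ℓ) → Colourable (remove2 G u v u≢v)
  assemble col = c , λ w e i e′ i′ ne p q same → proj₂ (proj₂ (col (label w))) w refl e i e′ i′ ne p q
      (trans (sym (agrees e i w p)) (trans same (agrees e′ i′ w q)))
    where
    κ : Fin k → Fin m → Fin 2 → Fin 3
    κ w = proj₁ (col (label w))
    pick : Fin m → Maybe (Fin k) → Maybe (Fin k) → Fin 3
    pick e (just w) _        = κ w e zero
    pick e nothing  (just w) = κ w e (suc zero)
    -- With both ends deleted, the edge is unconstrained.
    pick e nothing  nothing  = red
    c : Fin m → Fin 3
    c e = pick e (rest e zero) (rest e (suc zero))
    agrees : ∀ e i w → rest e i ≡ just w → c e ≡ κ w e i
    agrees e zero w p = cong (λ x → pick e x (rest e (suc zero))) p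
    agrees e (suc zero) w q = from-first (rest e zero) refl
      where
      from-first : ∀ x → rest e zero ≡ x → c e ≡ κ w e (suc zero)
      from-first nothing  p = cong₂ (pick e) p q
      from-first (just a) p = trans (cong₂ (pick e) p q)
        (trans (cong (λ ℓ → proj₁ (col ℓ) e zero) (label-edge e p q))
          (proj₁ (proj₂ (col (label w))) e (full⇒F-false e λ { zero → a , p ; (suc zero) → w , q })))

7-irreducible⇒bicritical : ∀ G → Cubic G → KIrreducible 7 G → Bicritical G
7-irreducible⇒bicritical (mkGraph (suc zero) m E) _ _ zero zero u≢v = contradiction refl u≢v
7-irreducible⇒bicritical G@(mkGraph (suc (suc k)) m E) cubic irreducible u v u≢v =
  -- Colourability is decidable by finite search, so its double negation suffices and the components
  -- may be coloured under one.
  decidable-stable (colourable? (remove2 G u v u≢v)) λ uncolourable →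
    ¬¬-all (some-colouring E cubic u v u≢v irreducible) λ col → uncolourable (assemble E cubic u v u≢v col)

theorem5 : (G : Graph) → Snark G →
    (Bicritical G ⇔ FourVertexCritical G) ×
    (Bicritical G ⇔ KIrreducible 7 G) ×
    (Bicritical G ⇔ Irreducible G)
theorem5 G (cubic , _) =
  mk⇔ (bicritical⇒critical G cubic) (critical⇒bicritical G cubic) ,
  mk⇔ (λ bicritical → bicritical⇒kIrreducible G cubic bicritical 7) (7-irreducible⇒bicritical G cubic) ,
  mk⇔ (λ bicritical k _ → bicritical⇒kIrreducible G cubic bicritical k)
    (λ irreducible → 7-irreducible⇒bicritical G cubic (irreducible 7 (s≤s z≤n)))
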